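{- Let $d\ge 1$, let $\widehat{F}_d$ be the free profinite group on $d$ generators, let $H$ be a finite group and let $\pi:\widehat{F}_d\to H$ be a continuous epimorphism with kernel $R$. Let $\overline{R}=R/[R,R]$, let $A(\pi)=\{\alpha\in\mathrm{Aut}(\widehat{F}_d):\pi\circ\alpha=\pi\}$, and let $\rho:A(\pi)\to\mathrm{GL}(\overline{R})$ be the homomorphism given by the induced action of $A(\pi)$ on $\overline{R}$. Let $\beta\in H^2(H,\overline{R})$ be the extension class of the short exact sequence $$1\to\overline{R}\to\widehat{F}_d/[R,R]\xrightarrow{\overline{\pi}}H\to 1,$$ where $\overline{\pi}$ is induced by $\pi$. Then the image $\rho(A(\pi))$ equals the group $\mathrm{Aut}_{H,\beta}(\overline{R})$ of all $\widehat{\mathbb{Z}}[H]$-module automorphisms $\gamma$ of $\overline{R}$ that preserve $\beta$, i.e. such that $\gamma_*(\beta)=\beta$ in $H^2(H,\overline{R})$.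
   Context: $[R,R]$ is the closed commutator subgroup, so $\overline{R}$ is the maximal abelian profinite quotient of $R$; it is a $\widehat{\mathbb{Z}}[H]$-module via the conjugation action of $\widehat{F}_d/[R,R]$. Automorphisms of profinite groups are continuous. For $\gamma$ an $H$-module automorphism of $\overline{R}$, $\gamma_*$ denotes the induced automorphism of $H^2(H,\overline{R})$. -}

module Defs where

open import Algebra.Bundles using (Group; AbelianGroup)
open import Algebra.Definitions.RawMonoid using () renaming (_×_ to pow)
open import Algebra.Morphism.Bundles using (GroupHomomorphism)
import Algebra.Properties.AbelianGroup as AbelianGroupProperties
import Algebra.Properties.CommutativeSemigroup as CommutativeSemigroupProperties
import Algebra.Properties.Group as GroupProperties
import Algebra.Properties.Monoid.Mult as Mult
open import Data.Fin.Base using (Fin; toℕ)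
open import Data.Fin.Properties using (pigeonhole; toℕ≤pred[n])
open import Data.List.Base using (List; []; _∷_; foldr)
open import Data.Nat.Base as ℕ using (ℕ; NonZero; _!)
open import Data.Nat.Divisibility using (_∣_; divides; m∣m*n; n∣m*n; ∣-trans; m≤n⇒m!∣n!)
open import Data.Nat.DivMod using (_%_; _/_; m≡m%n+[m/n]*n)
import Data.Nat.Properties as ℕ
open import Data.Product.Base using (Σ; ∃; _×_; _,_; proj₁; proj₂)
open import Data.Unit.Base using (⊤; tt)
open import Function.Bundles using (Inverse)
open import Function.Definitions using (Congruent; Injective; Surjective)
open import Level using (0ℓ)
open import Relation.Binary.Bundles using (Setoid)
open import Relation.Binary.PropositionalEquality as ≡ using (_≡_)
import Relation.Binary.Reasoning.Setoid as SetoidReasoning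
open import Relation.Unary using (Pred; _⊆_)

------------------------------------------------------------------------
-- Subgroups, quotients, homomorphisms

Grp : Set₁
Grp = Group 0ℓ 0ℓ

record Subgroup (G : Grp) : Set₁ where
  open Group G
  field
    Mem       : Pred Carrier 0ℓ
    resp      : ∀ {x y} → x ≈ y → Mem x → Mem y
    ε-closed  : Mem ε
    ∙-closed  : ∀ {x y} → Mem x → Mem y → Mem (x ∙ y)
    ⁻¹-closed : ∀ {x} → Mem x → Mem (x ⁻¹)

record NormalSubgroup (G : Grp) : Set₁ where
  open Group G
  field
    subgroup    : Subgroup G
  open Subgroup subgroup public
  field
    conj-closed : ∀ g {x} → Mem x → Mem (g ∙ x ∙ g ⁻¹)

open NormalSubgroup public using () renaming (Mem to ⟨_⟩)

subgroupGroup : (G : Grp) → Subgroup G → Grp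
subgroupGroup G S = record
  { Carrier = Σ Carrier Mem
  ; _≈_     = λ x y → proj₁ x ≈ proj₁ y
  ; _∙_     = λ (x , p) (y , q) → x ∙ y , ∙-closed p q
  ; ε       = ε , ε-closed
  ; _⁻¹     = λ (x , p) → x ⁻¹ , ⁻¹-closed p
  ; isGroup = record
    { isMonoid = record
      { isSemigroup = record
        { isMagma = record
          { isEquivalence = record { refl = refl ; sym = sym ; trans = trans }
          ; ∙-cong = ∙-cong }
        ; assoc = λ x y z → assoc (proj₁ x) (proj₁ y) (proj₁ z) }
      ; identity = (λ x → identityˡ (proj₁ x)) , (λ x → identityʳ (proj₁ x)) }
    ; inverse = (λ x → inverseˡ (proj₁ x)) , (λ x → inverseʳ (proj₁ x))
    ; ⁻¹-cong = ⁻¹-cong } }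
  where open Group G
        open Subgroup S

module Quotient (G : Grp) (N : NormalSubgroup G) where
  open Group G
  open GroupProperties G
  open NormalSubgroup N
  open SetoidReasoning setoid

  infix 4 _∼_

  _∼_ : Carrier → Carrier → Set
  x ∼ y = Mem (x ⁻¹ ∙ y)

  ≈⇒∼ : ∀ {x y} → x ≈ y → x ∼ y
  ≈⇒∼ {x} x≈y = resp (trans (sym (inverseˡ x)) (∙-congˡ x≈y)) ε-closed

  ∼-sym : ∀ {x y} → x ∼ y → y ∼ x
  ∼-sym {x} {y} p = resp (⁻¹-anti-homo-\\ x y) (⁻¹-closed p)

  ∼-trans : ∀ {x y z} → x ∼ y → y ∼ z → x ∼ z
  ∼-trans {x} {y} {z} p q = resp eq (∙-closed p q)
    where
    eq : x ⁻¹ ∙ y ∙ (y ⁻¹ ∙ z) ≈ x ⁻¹ ∙ z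
    eq = trans (assoc _ _ _) (∙-congˡ (\\-leftDividesˡ y z))

  ∼-∙-cong : ∀ {x y u v} → x ∼ y → u ∼ v → x ∙ u ∼ y ∙ v
  ∼-∙-cong {x} {y} {u} {v} p q = resp eq (∙-closed (conj-closed (u ⁻¹) p) q)
    where
    eq : u ⁻¹ ∙ (x ⁻¹ ∙ y) ∙ u ⁻¹ ⁻¹ ∙ (u ⁻¹ ∙ v) ≈ (x ∙ u) ⁻¹ ∙ (y ∙ v)
    eq = begin
      u ⁻¹ ∙ (x ⁻¹ ∙ y) ∙ u ⁻¹ ⁻¹ ∙ (u ⁻¹ ∙ v)   ≈⟨ assoc _ _ _ ⟩
      u ⁻¹ ∙ (x ⁻¹ ∙ y) ∙ (u ⁻¹ ⁻¹ ∙ (u ⁻¹ ∙ v)) ≈⟨ ∙-congˡ (\\-leftDividesʳ (u ⁻¹) v) ⟩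
      u ⁻¹ ∙ (x ⁻¹ ∙ y) ∙ v                      ≈⟨ ∙-congʳ (assoc _ _ _) ⟨
      u ⁻¹ ∙ x ⁻¹ ∙ y ∙ v                        ≈⟨ assoc _ _ _ ⟩
      u ⁻¹ ∙ x ⁻¹ ∙ (y ∙ v)                      ≈⟨ ∙-congʳ (⁻¹-anti-homo-∙ x u) ⟨
      (x ∙ u) ⁻¹ ∙ (y ∙ v)                       ∎

  ∼-⁻¹-cong : ∀ {x y} → x ∼ y → x ⁻¹ ∼ y ⁻¹
  ∼-⁻¹-cong {x} {y} p = resp eq (conj-closed x (∼-sym p))
    where
    eq : x ∙ (y ⁻¹ ∙ x) ∙ x ⁻¹ ≈ x ⁻¹ ⁻¹ ∙ y ⁻¹
    eq = begin
      x ∙ (y ⁻¹ ∙ x) ∙ x ⁻¹ ≈⟨ assoc _ _ _ ⟩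
      x ∙ (y ⁻¹ ∙ x ∙ x ⁻¹) ≈⟨ ∙-congˡ (//-rightDividesʳ x (y ⁻¹)) ⟩
      x ∙ y ⁻¹              ≈⟨ ∙-congʳ (⁻¹-involutive x) ⟨
      x ⁻¹ ⁻¹ ∙ y ⁻¹        ∎

  group : Grp
  group = record
    { Carrier = Carrier
    ; _≈_     = _∼_
    ; _∙_     = _∙_
    ; ε       = ε
    ; _⁻¹     = _⁻¹
    ; isGroup = record
      { isMonoid = record
        { isSemigroup = record
          { isMagma = record
            { isEquivalence = record
              { refl = ≈⇒∼ refl ; sym = ∼-sym ; trans = ∼-trans }
            ; ∙-cong = ∼-∙-cong }
          ; assoc = λ x y z → ≈⇒∼ (assoc x y z) }
        ; identity = (λ x → ≈⇒∼ (identityˡ x)) , (λ x → ≈⇒∼ (identityʳ x)) }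
      ; inverse = (λ x → ≈⇒∼ (inverseˡ x)) , (λ x → ≈⇒∼ (inverseʳ x))
      ; ⁻¹-cong = ∼-⁻¹-cong } }

  Mem⇒∼ε : ∀ {x} → Mem x → x ∼ ε
  Mem⇒∼ε p = resp (sym (identityʳ _)) (⁻¹-closed p)

  ∼ε⇒Mem : ∀ {x} → x ∼ ε → Mem x
  ∼ε⇒Mem {x} p = resp (trans (⁻¹-cong (identityʳ _)) (⁻¹-involutive x)) (⁻¹-closed p)

quotientGroup : (G : Grp) → NormalSubgroup G → Grp
quotientGroup G N = Quotient.group G N

Hom : Grp → Grp → Set
Hom G G′ = GroupHomomorphism (Group.rawGroup G) (Group.rawGroup G′)

open GroupHomomorphism public using (⟦_⟧)

mkHom : (G G′ : Grp) (f : Group.Carrier G → Group.Carrier G′) →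
        Congruent (Group._≈_ G) (Group._≈_ G′) f →
        (∀ x y → Group._≈_ G′ (f (Group._∙_ G x y)) (Group._∙_ G′ (f x) (f y))) →
        Hom G G′
mkHom G G′ f f-cong f-homo = record
  { ⟦_⟧ = f
  ; isGroupHomomorphism = record
    { isMonoidHomomorphism = record
      { isMagmaHomomorphism = record
        { isRelHomomorphism = record { cong = f-cong }
        ; homo = f-homo }
      ; ε-homo = ε-homo }
    ; ⁻¹-homo = λ x → inverseˡ-unique (f (x G.⁻¹)) (f x)
        (trans (sym (f-homo _ _)) (trans (f-cong (G.inverseˡ x)) ε-homo)) } }
  where
  module G = Group G
  open Group G′
  open GroupProperties G′
  ε-homo : f G.ε ≈ ε
  ε-homo = identityʳ-unique (f G.ε) (f G.ε)
    (trans (sym (f-homo _ _)) (f-cong (G.identityˡ G.ε)))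

conjugation : (G : Grp) → Group.Carrier G → Hom G G
conjugation G g = mkHom G G (λ x → g ∙ x ∙ g ⁻¹) (λ p → ∙-congʳ (∙-congˡ p)) homo
  where
  open Group G
  open GroupProperties G
  open SetoidReasoning setoid
  homo : ∀ x y → g ∙ (x ∙ y) ∙ g ⁻¹ ≈ g ∙ x ∙ g ⁻¹ ∙ (g ∙ y ∙ g ⁻¹)
  homo x y = begin
    g ∙ (x ∙ y) ∙ g ⁻¹               ≈⟨ ∙-congʳ (assoc _ _ _) ⟨
    g ∙ x ∙ y ∙ g ⁻¹                 ≈⟨ assoc _ _ _ ⟩
    g ∙ x ∙ (y ∙ g ⁻¹)               ≈⟨ ∙-congˡ (\\-leftDividesʳ g _) ⟨
    g ∙ x ∙ (g ⁻¹ ∙ (g ∙ (y ∙ g ⁻¹))) ≈⟨ assoc _ _ _ ⟨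
    g ∙ x ∙ g ⁻¹ ∙ (g ∙ (y ∙ g ⁻¹))  ≈⟨ ∙-congˡ (assoc _ _ _) ⟨
    g ∙ x ∙ g ⁻¹ ∙ (g ∙ y ∙ g ⁻¹)    ∎

kernel : (G G′ : Grp) → Hom G G′ → NormalSubgroup G
kernel G G′ f = record
  { subgroup = record
    { Mem       = λ x → ⟦ f ⟧ x ≈ ε
    ; resp      = λ p q → trans (f.⟦⟧-cong (G.sym p)) q
    ; ε-closed  = f.ε-homo
    ; ∙-closed  = λ p q → trans (f.homo _ _) (trans (∙-cong p q) (identityˡ ε))
    ; ⁻¹-closed = λ p → trans (f.⁻¹-homo _) (trans (⁻¹-cong p) ε⁻¹≈ε) }
  ; conj-closed = λ g p → trans (f.homo _ _) (trans
      (∙-cong (trans (f.homo _ _) (trans (∙-congˡ p) (identityʳ _))) (f.⁻¹-homo g))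
      (inverseʳ _)) }
  where
  module G = Group G
  module f = GroupHomomorphism f
  open Group G′
  open GroupProperties G′

-- The subgroup generated by the commutators.
data Commutators (G : Grp) : Pred (Group.Carrier G) 0ℓ where
  [_,_] : ∀ x y → let open Group G in Commutators G ((x ⁻¹ ∙ y ⁻¹) ∙ (x ∙ y))
  resp  : ∀ {x y} → Group._≈_ G x y → Commutators G x → Commutators G y
  unit  : Commutators G (Group.ε G)
  mul   : ∀ {x y} → Commutators G x → Commutators G y → Commutators G (Group._∙_ G x y)
  inv   : ∀ {x} → Commutators G x → Commutators G (Group._⁻¹ G x)

Commutators-map : (G G′ : Grp) (f : Hom G G′) →
                  ∀ {x} → Commutators G x → Commutators G′ (⟦ f ⟧ x)
Commutators-map G G′ f [ x , y ] = resp (sym eq) [ ⟦ f ⟧ x , ⟦ f ⟧ y ]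
  where
  open Group G′
  open GroupHomomorphism f using (homo; ⁻¹-homo)
  eq = trans (homo _ _) (∙-cong (trans (homo _ _) (∙-cong (⁻¹-homo x) (⁻¹-homo y))) (homo x y))
Commutators-map G G′ f (resp p c) =
  resp (GroupHomomorphism.⟦⟧-cong f p) (Commutators-map G G′ f c)
Commutators-map G G′ f unit = resp (Group.sym G′ (GroupHomomorphism.ε-homo f)) unit
Commutators-map G G′ f (mul c d) = resp (Group.sym G′ (GroupHomomorphism.homo f _ _))
  (mul (Commutators-map G G′ f c) (Commutators-map G G′ f d))
Commutators-map G G′ f (inv c) = resp (Group.sym G′ (GroupHomomorphism.⁻¹-homo f _))
  (inv (Commutators-map G G′ f c))

derived : (G : Grp) → NormalSubgroup G
derived G = record
  { subgroup = record
    { Mem = Commutators G ; resp = resp ; ε-closed = unit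
    ; ∙-closed = mul ; ⁻¹-closed = inv }
  ; conj-closed = λ g → Commutators-map G G (conjugation G g) }

-- A · N = ⋃ { a N ∣ a ∈ A }, as a normal subgroup of G / N.
product/ : (G : Grp) (A N : NormalSubgroup G) → NormalSubgroup (quotientGroup G N)
product/ G A N = record
  { subgroup = record
    { Mem       = λ x → ∃ λ a → ⟨ A ⟩ a × a ∼ x
    ; resp      = λ p (a , m , q) → a , m , ∼-trans q p
    ; ε-closed  = ε , A.ε-closed , ≈⇒∼ refl
    ; ∙-closed  = λ (a , m , p) (b , n , q) → a ∙ b , A.∙-closed m n , ∼-∙-cong p q
    ; ⁻¹-closed = λ (a , m , p) → a ⁻¹ , A.⁻¹-closed m , ∼-⁻¹-cong p }
  ; conj-closed = λ g (a , m , p) → g ∙ a ∙ g ⁻¹ , A.conj-closed g m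
      , ∼-∙-cong (∼-∙-cong (≈⇒∼ refl) p) (≈⇒∼ refl) }
  where
  open Group G
  open Quotient G N
  module A = NormalSubgroup A

product : (G : Grp) (A N : NormalSubgroup G) → NormalSubgroup G
product G A N = record
  { subgroup = record
    { Mem = AN.Mem
    ; resp = λ p → AN.resp (Quotient.≈⇒∼ G N p)
    ; ε-closed = AN.ε-closed
    ; ∙-closed = AN.∙-closed
    ; ⁻¹-closed = AN.⁻¹-closed }
  ; conj-closed = AN.conj-closed }
  where module AN = NormalSubgroup (product/ G A N)

------------------------------------------------------------------------
-- Topological groups

-- A group topology is given by a fundamental system of neighbourhoods of ε
-- consisting of (open) normal subgroups.  Every profinite group, and every
-- subgroup and quotient of one, has its topology given in this way.
record TopGroup : Set₁ where
  field
    group     : Grp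
    Index     : Set
    inhabited : Index
    Nbhd      : Index → NormalSubgroup group
    directed  : ∀ i j → ∃ λ k → ⟨ Nbhd k ⟩ ⊆ ⟨ Nbhd i ⟩ × ⟨ Nbhd k ⟩ ⊆ ⟨ Nbhd j ⟩
  open Group group public

  infix 4 _≈[_]_
  _≈[_]_ : Carrier → Index → Carrier → Set
  x ≈[ i ] y = ⟨ Nbhd i ⟩ (x ⁻¹ ∙ y)

  quotient : Index → Grp
  quotient i = quotientGroup group (Nbhd i)

record ContHom (G G′ : TopGroup) : Set where
  private
    module G  = TopGroup G
    module G′ = TopGroup G′
  field
    hom        : Hom G.group G′.group
    continuous : ∀ j → ∃ λ i → ∀ {x} → ⟨ G.Nbhd i ⟩ x → ⟨ G′.Nbhd j ⟩ (⟦ hom ⟧ x)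
  open GroupHomomorphism hom public using (⟦⟧-cong; homo; ε-homo; ⁻¹-homo)
  apply : G.Carrier → G′.Carrier
  apply = ⟦ hom ⟧

open ContHom public using (apply)

record TopAut (G : TopGroup) : Set where
  open TopGroup G
  field
    to   : ContHom G G
    from : ContHom G G
    invˡ : ∀ x → apply to (apply from x) ≈ x
    invʳ : ∀ x → apply from (apply to x) ≈ x

infix 4 _≈Aut_
_≈Aut_ : {G : TopGroup} → TopAut G → TopAut G → Set
_≈Aut_ {G} α β = ∀ x → TopGroup._≈_ G (apply (TopAut.to α) x) (apply (TopAut.to β) x)

subspace : (G : TopGroup) → Subgroup (TopGroup.group G) → TopGroup
subspace G S = record
  { group = subgroupGroup group S
  ; Index = Index
  ; inhabited = inhabited
  ; Nbhd = λ i → let module N = NormalSubgroup (Nbhd i) in record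
    { subgroup = record
      { Mem = λ x → ⟨ Nbhd i ⟩ (proj₁ x)
      ; resp = N.resp ; ε-closed = N.ε-closed
      ; ∙-closed = N.∙-closed ; ⁻¹-closed = N.⁻¹-closed }
    ; conj-closed = λ g → N.conj-closed (proj₁ g) }
  ; directed = λ i j → let (k , p , q) = directed i j in k , (λ m → p m) , (λ m → q m) }
  where open TopGroup G

quotientSpace : (G : TopGroup) → NormalSubgroup (TopGroup.group G) → TopGroup
quotientSpace G N = record
  { group = quotientGroup group N
  ; Index = Index
  ; inhabited = inhabited
  ; Nbhd = λ i → product/ group (Nbhd i) N
  ; directed = λ i j → let (k , p , q) = directed i j in
      k , (λ (a , m , e) → a , p m , e) , (λ (a , m , e) → a , q m , e) }
  where open TopGroup G

-- The closure of N is the intersection of the N · U, U an open normal subgroup.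
closure : (G : TopGroup) → NormalSubgroup (TopGroup.group G) → NormalSubgroup (TopGroup.group G)
closure G N = record
  { subgroup = record
    { Mem       = λ x → ∀ i → ⟨ NU i ⟩ x
    ; resp      = λ p m i → NormalSubgroup.resp (NU i) p (m i)
    ; ε-closed  = λ i → NormalSubgroup.ε-closed (NU i)
    ; ∙-closed  = λ m n i → NormalSubgroup.∙-closed (NU i) (m i) (n i)
    ; ⁻¹-closed = λ m i → NormalSubgroup.⁻¹-closed (NU i) (m i) }
  ; conj-closed = λ g m i → NormalSubgroup.conj-closed (NU i) g (m i) }
  where
  open TopGroup G
  NU : Index → NormalSubgroup group
  NU i = product group N (Nbhd i)

closedDerived : (G : TopGroup) → NormalSubgroup (TopGroup.group G)
closedDerived G = closure G (derived (TopGroup.group G))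

closedDerived-map : (G G′ : TopGroup) (f : ContHom G G′) →
                    ∀ {x} → ⟨ closedDerived G ⟩ x → ⟨ closedDerived G′ ⟩ (apply f x)
closedDerived-map G G′ f {x} m j =
  let (i , f-cont) = ContHom.continuous f j
      (a , c , p)  = m i
  in apply f a , Commutators-map G.group group (ContHom.hom f) c ,
     NormalSubgroup.resp (Nbhd j)
       (trans (ContHom.homo f _ _) (∙-congʳ (ContHom.⁻¹-homo f a))) (f-cont p)
  where
  module G = TopGroup G
  open TopGroup G′

restrict : (G : TopGroup) (S : Subgroup (TopGroup.group G)) (f : ContHom G G) →
           (∀ {x} → Subgroup.Mem S x → Subgroup.Mem S (apply f x)) →
           ContHom (subspace G S) (subspace G S)
restrict G S f f-S = record
  { hom = mkHom (subgroupGroup group S) (subgroupGroup group S)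
      (λ (x , p) → apply f x , f-S p) (ContHom.⟦⟧-cong f) (λ _ _ → ContHom.homo f _ _)
  ; continuous = λ j → let (i , c) = ContHom.continuous f j in i , λ m → c m }
  where open TopGroup G

descend : (G : TopGroup) (N : NormalSubgroup (TopGroup.group G)) (f : ContHom G G) →
          (∀ {x} → ⟨ N ⟩ x → ⟨ N ⟩ (apply f x)) →
          ContHom (quotientSpace G N) (quotientSpace G N)
descend G N f f-N = record
  { hom = mkHom (quotientGroup group N) (quotientGroup group N) (apply f) f-cong
      (λ _ _ → Quotient.≈⇒∼ group N (ContHom.homo f _ _))
  ; continuous = λ j → let (i , c) = ContHom.continuous f j in
      i , λ (a , m , e) → apply f a , c m , f-cong e }
  where
  open TopGroup G
  f-cong : ∀ {x y} → ⟨ N ⟩ (x ⁻¹ ∙ y) → ⟨ N ⟩ (apply f x ⁻¹ ∙ apply f y)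
  f-cong {x} m = NormalSubgroup.resp N
    (trans (ContHom.homo f _ _) (∙-congʳ (ContHom.⁻¹-homo f x))) (f-N m)

------------------------------------------------------------------------
-- Finite and profinite groups

Finite : Setoid 0ℓ 0ℓ → Set
Finite S = ∃ λ n → Inverse S (≡.setoid (Fin n))

record FiniteGroup : Set₁ where
  field
    group  : Grp
    finite : Finite (Group.setoid group)
  open Group group public

discrete : FiniteGroup → TopGroup
discrete H = record
  { group = group
  ; Index = ⊤
  ; inhabited = tt
  ; Nbhd = λ _ → record
    { subgroup = record
      { Mem = _≈ ε
      ; resp = λ p q → trans (sym p) q
      ; ε-closed = refl
      ; ∙-closed = λ p q → trans (∙-cong p q) (identityˡ ε)
      ; ⁻¹-closed = λ p → trans (⁻¹-cong p) ε⁻¹≈ε }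
    ; conj-closed = λ g p → trans (∙-congʳ (trans (∙-congˡ p) (identityʳ g))) (inverseʳ g) }
  ; directed = λ _ _ → tt , (λ p → p) , (λ p → p) }
  where
  open FiniteGroup H
  open GroupProperties group

-- A profinite group is an inverse limit of finite groups: the quotients by
-- the basic open normal subgroups are finite, and the canonical map from the
-- group to the inverse limit of these quotients is bijective.
record ProfiniteGroup : Set₁ where
  field
    top : TopGroup
  open TopGroup top public
  field
    finite    : ∀ i → Finite (Group.setoid (quotient i))
    separated : ∀ {x y} → (∀ i → x ≈[ i ] y) → x ≈ y
    complete  : (x : Index → Carrier) →
                (∀ {i j} → ⟨ Nbhd j ⟩ ⊆ ⟨ Nbhd i ⟩ → x i ≈[ i ] x j) →
                ∃ λ y → ∀ i → y ≈[ i ] x i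

IsFreeProfinite : (F : ProfiniteGroup) {d : ℕ} → (Fin d → ProfiniteGroup.Carrier F) → Set₁
IsFreeProfinite F {d} x =
  (G : ProfiniteGroup) → let open ProfiniteGroup G in (g : Fin d → Carrier) →
  Σ (ContHom F.top top) λ φ →
    (∀ k → apply φ (x k) ≈ g k) ×
    ((ψ : ContHom F.top top) → (∀ k → apply ψ (x k) ≈ g k) → ∀ y → apply ψ y ≈ apply φ y)
  where module F = ProfiniteGroup F

------------------------------------------------------------------------
-- Powers with exponents in the profinite completion of ℤ

-- An element of lim ℤ/n, given by representatives of its components.
record Ẑ : Set where
  field
    residue    : (n : ℕ) .{{_ : NonZero n}} → ℕ
    compatible : ∀ {m n} .{{_ : NonZero m}} .{{_ : NonZero n}} →
                 m ∣ n → residue n % m ≡ residue m % m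

1̂ : Ẑ
1̂ = record { residue = λ _ → 1 ; compatible = λ _ → ≡.refl }

module Power (G : Grp) where
  open Group G
  open GroupProperties G
  open Mult monoid
  open SetoidReasoning setoid

  infixr 8 _^_
  _^_ : Carrier → ℕ → Carrier
  x ^ n = pow rawMonoid n x

  ε^ : ∀ n → ε ^ n ≈ ε
  ε^ ℕ.zero    = refl
  ε^ (ℕ.suc n) = trans (identityˡ _) (ε^ n)

  ^-mod : ∀ x k .{{_ : NonZero k}} → x ^ k ≈ ε → ∀ p → x ^ p ≈ x ^ (p % k)
  ^-mod x k xᵏ≈ε p = begin
    x ^ p                          ≡⟨ ≡.cong (x ^_) (m≡m%n+[m/n]*n p k) ⟩
    x ^ (p % k ℕ.+ p / k ℕ.* k)    ≈⟨ ×-homo-+ x (p % k) _ ⟩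
    x ^ (p % k) ∙ x ^ (p / k ℕ.* k) ≈⟨ ∙-congˡ (×-assocˡ x (p / k) k) ⟨
    x ^ (p % k) ∙ (x ^ k) ^ (p / k) ≈⟨ ∙-congˡ (×-congʳ (p / k) xᵏ≈ε) ⟩
    x ^ (p % k) ∙ ε ^ (p / k)       ≈⟨ ∙-congˡ (ε^ (p / k)) ⟩
    x ^ (p % k) ∙ ε                 ≈⟨ identityʳ _ ⟩
    x ^ (p % k)                     ∎

  ^-mod-cong : ∀ x k .{{_ : NonZero k}} → x ^ k ≈ ε →
               ∀ {p q} → p % k ≡ q % k → x ^ p ≈ x ^ q
  ^-mod-cong x k xᵏ≈ε {p} {q} p≡q = trans (^-mod x k xᵏ≈ε p)
    (trans (reflexive (≡.cong (x ^_) p≡q)) (sym (^-mod x k xᵏ≈ε q)))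

  module _ (fin : Finite setoid) where
    private
      n = proj₁ fin
      module fin = Inverse (proj₂ fin)
      open fin using (to)

      to-injective : ∀ {x y} → to x ≡ to y → x ≈ y
      to-injective eq = trans (sym (fin.inverseʳ ≡.refl)) (fin.inverseʳ eq)

    ^-finite : ∀ x → x ^ (n !) ≈ ε
    ^-finite x
      with i , j , i<j , eq ← pigeonhole (ℕ.n<1+n n) (λ i → to (x ^ toℕ i))
      with k , 1+i+k≡j ← ℕ.m≤n⇒∃[o]m+o≡n i<j
      with divides q n!≡q*1+k ← ∣-trans (m∣m*n (k !))
             (m≤n⇒m!∣n! (ℕ.≤-trans (ℕ.m+n≤o⇒n≤o (toℕ i) (ℕ.≤-reflexive
               (≡.trans (ℕ.+-suc (toℕ i) k) 1+i+k≡j))) (toℕ≤pred[n] j)))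
      = begin
        x ^ (n !)             ≡⟨ ≡.cong (x ^_) n!≡q*1+k ⟩
        x ^ (q ℕ.* ℕ.suc k)   ≈⟨ ×-assocˡ x q (ℕ.suc k) ⟨
        (x ^ ℕ.suc k) ^ q     ≈⟨ ×-congʳ q x^1+k≈ε ⟩
        ε ^ q                 ≈⟨ ε^ q ⟩
        ε                     ∎
      where
      x^1+k≈ε : x ^ ℕ.suc k ≈ ε
      x^1+k≈ε = identityʳ-unique (x ^ toℕ i) (x ^ ℕ.suc k) (begin
        x ^ toℕ i ∙ x ^ ℕ.suc k ≈⟨ ×-homo-+ x (toℕ i) (ℕ.suc k) ⟨
        x ^ (toℕ i ℕ.+ ℕ.suc k) ≡⟨ ≡.cong (x ^_) (≡.trans (ℕ.+-suc (toℕ i) k) 1+i+k≡j) ⟩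
        x ^ toℕ j               ≈⟨ to-injective eq ⟨
        x ^ toℕ i               ∎)

module ẐPower (F : ProfiniteGroup) where
  open ProfiniteGroup F
  open Power group

  ord : Index → ℕ
  ord i = proj₁ (finite i) !

  ord≢0 : ∀ i → NonZero (ord i)
  ord≢0 i = ℕ._!≢0 (proj₁ (finite i))

  quotient-^ : ∀ i x n → Power._^_ (quotient i) x n ≡ x ^ n
  quotient-^ i x ℕ.zero    = ≡.refl
  quotient-^ i x (ℕ.suc n) = ≡.cong (x ∙_) (quotient-^ i x n)

  ^-mod-ord : ∀ i x {p q} → (_%_ p (ord i) {{ord≢0 i}}) ≡ (_%_ q (ord i) {{ord≢0 i}}) →
              x ^ p ≈[ i ] x ^ q
  ^-mod-ord i x {p} {q} eq = ≡.subst₂ _≈[ i ]_ (quotient-^ i x p) (quotient-^ i x q)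
    (Power.^-mod-cong (quotient i) x (ord i) {{ord≢0 i}}
      (Power.^-finite (quotient i) (finite i) x) {p} {q} eq)

  approx : Carrier → Ẑ → Index → Carrier
  approx x z i = x ^ Ẑ.residue z (ord i) {{ord≢0 i}}

  approx-coherent : ∀ x z {i j} → ⟨ Nbhd j ⟩ ⊆ ⟨ Nbhd i ⟩ → approx x z i ≈[ i ] approx x z j
  approx-coherent x z {i} {j} j⊆i = Quotient.∼-trans group (Nbhd i)
    (^-mod-ord i x (≡.sym (compatible (m∣m*n (ord j)))))
    (j⊆i (^-mod-ord j x (compatible (n∣m*n (ord i)))))
    where
    open Ẑ z
    instance
      _ = ord≢0 i
      _ = ord≢0 j
      _ = ℕ.m*n≢0 (ord i) (ord j)

  -- x ^̂ z is the limit of the powers x ^ (z mod n!) as n grows: modulo the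
  -- basic subgroup U only z mod ∣F/U∣! matters.
  infixr 8 _^̂_
  _^̂_ : Carrier → Ẑ → Carrier
  x ^̂ z = proj₁ (complete (approx x z) (approx-coherent x z))

  ^̂-approx : ∀ x z i → ∃ λ n → (x ^̂ z) ≈[ i ] x ^ n
  ^̂-approx x z i = Ẑ.residue z (ord i) {{ord≢0 i}} , proj₂ (complete (approx x z) (approx-coherent x z)) i

  ^̂-1̂ : ∀ x → x ^̂ 1̂ ≈ x
  ^̂-1̂ x = trans (separated (proj₂ (complete (approx x 1̂) (approx-coherent x 1̂))))
    (identityʳ x)

------------------------------------------------------------------------
-- Second cohomology

record HModule (H : Grp) : Set₁ where
  private module H = Group H
  field
    abelianGroup : AbelianGroup 0ℓ 0ℓ
  open AbelianGroup abelianGroup public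
  infixr 8 _·_
  field
    _·_      : H.Carrier → Carrier → Carrier
    ·-cong   : ∀ {g h a b} → g H.≈ h → a ≈ b → g · a ≈ h · b
    ·-distrib : ∀ g a b → g · (a ∙ b) ≈ g · a ∙ g · b
    ·-unit   : ∀ a → H.ε · a ≈ a
    ·-assoc  : ∀ g h a → (g H.∙ h) · a ≈ g · (h · a)

  ·-⁻¹ : ∀ g a → g · (a ⁻¹) ≈ (g · a) ⁻¹
  ·-⁻¹ g = GroupHomomorphism.⁻¹-homo
    (mkHom group group (g ·_) (·-cong H.refl) (·-distrib g))

  ·-ε : ∀ g → g · ε ≈ ε
  ·-ε g = GroupHomomorphism.ε-homo
    (mkHom group group (g ·_) (·-cong H.refl) (·-distrib g))

record HModuleHom {H : Grp} (M M′ : HModule H) : Set where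
  private
    module M  = HModule M
    module M′ = HModule M′
  field
    hom         : Hom M.group M′.group
    equivariant : ∀ h a → ⟦ hom ⟧ (h M.· a) M′.≈ h M′.· ⟦ hom ⟧ a
  open GroupHomomorphism hom public using (⟦⟧-cong; homo; ⁻¹-homo)

-- H²(H, M) = Z²(H, M) / B²(H, M), by inhomogeneous cochains.
module _ {H : Grp} (M : HModule H) where
  private module H = Group H
  open HModule M
  open AbelianGroupProperties abelianGroup using (⁻¹-∙-comm; ε⁻¹≈ε; xyx⁻¹≈y)
  open CommutativeSemigroupProperties commutativeSemigroup using (interchange)

  record Cocycle₂ : Set where
    field
      fun     : H.Carrier → H.Carrier → Carrier
      cong    : ∀ {g g′ h h′} → g H.≈ g′ → h H.≈ h′ → fun g h ≈ fun g′ h′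
      cocycle : ∀ g h k → g · fun h k ∙ fun g (h H.∙ k) ≈ fun (g H.∙ h) k ∙ fun g h

  open Cocycle₂

  Z² : Grp
  Z² = record
    { Carrier = Cocycle₂
    ; _≈_ = λ c d → ∀ g h → fun c g h ≈ fun d g h
    ; _∙_ = λ c d → record
      { fun = λ g h → fun c g h ∙ fun d g h
      ; cong = λ p q → ∙-cong (cong c p q) (cong d p q)
      ; cocycle = λ g h k → trans (∙-congʳ (·-distrib g _ _)) (trans (interchange _ _ _ _)
          (trans (∙-cong (cocycle c g h k) (cocycle d g h k)) (interchange _ _ _ _))) }
    ; ε = record
      { fun = λ _ _ → ε
      ; cong = λ _ _ → refl
      ; cocycle = λ g h k → ∙-congʳ (·-ε g) }
    ; _⁻¹ = λ c → record
      { fun = λ g h → fun c g h ⁻¹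
      ; cong = λ p q → ⁻¹-cong (cong c p q)
      ; cocycle = λ g h k → trans (∙-congʳ (·-⁻¹ g _)) (trans (⁻¹-∙-comm _ _)
          (trans (⁻¹-cong (cocycle c g h k)) (sym (⁻¹-∙-comm _ _)))) }
    ; isGroup = record
      { isMonoid = record
        { isSemigroup = record
          { isMagma = record
            { isEquivalence = record
              { refl = λ _ _ → refl
              ; sym = λ p g h → sym (p g h)
              ; trans = λ p q g h → trans (p g h) (q g h) }
            ; ∙-cong = λ p q g h → ∙-cong (p g h) (q g h) }
          ; assoc = λ c d e g h → assoc _ _ _ }
        ; identity = (λ c g h → identityˡ _) , (λ c g h → identityʳ _) }
      ; inverse = (λ c g h → inverseˡ _) , (λ c g h → inverseʳ _)
      ; ⁻¹-cong = λ p g h → ⁻¹-cong (p g h) } }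

  record IsCoboundary (c : Cocycle₂) : Set where
    field
      cochain    : H.Carrier → Carrier
      cong₁      : ∀ {g h} → g H.≈ h → cochain g ≈ cochain h
      coboundary : ∀ g h → fun c g h ≈ (g · cochain h ∙ cochain g) ∙ cochain (g H.∙ h) ⁻¹

  open IsCoboundary

  B² : NormalSubgroup Z²
  B² = record
    { subgroup = record
      { Mem = IsCoboundary
      ; resp = λ p m → record
        { cochain = cochain m ; cong₁ = cong₁ m
        ; coboundary = λ g h → trans (sym (p g h)) (coboundary m g h) }
      ; ε-closed = record
        { cochain = λ _ → ε ; cong₁ = λ _ → refl
        ; coboundary = λ g h → sym (trans (∙-cong (trans (identityʳ _) (·-ε g)) ε⁻¹≈ε) (identityˡ ε)) }
      ; ∙-closed = λ m n → record
        { cochain = λ g → cochain m g ∙ cochain n g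
        ; cong₁ = λ p → ∙-cong (cong₁ m p) (cong₁ n p)
        ; coboundary = λ g h → trans (∙-cong (coboundary m g h) (coboundary n g h))
            (trans (interchange _ _ _ _) (∙-cong
              (trans (interchange _ _ _ _) (∙-congʳ (sym (·-distrib g _ _))))
              (⁻¹-∙-comm _ _))) }
      ; ⁻¹-closed = λ m → record
        { cochain = λ g → cochain m g ⁻¹
        ; cong₁ = λ p → ⁻¹-cong (cong₁ m p)
        ; coboundary = λ g h → trans (⁻¹-cong (coboundary m g h)) (trans (sym (⁻¹-∙-comm _ _))
            (∙-congʳ (trans (sym (⁻¹-∙-comm _ _)) (∙-congʳ (sym (·-⁻¹ g _)))))) } }
    ; conj-closed = λ d {c} m → record
      { cochain = cochain m ; cong₁ = cong₁ m
      ; coboundary = λ g h → trans (xyx⁻¹≈y (fun d g h) (fun c g h)) (coboundary m g h) } }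

  H² : Grp
  H² = quotientGroup Z² B²

H²-map : {H : Grp} {M M′ : HModule H} → HModuleHom M M′ → Hom (H² M) (H² M′)
H²-map {H} {M} {M′} f = mkHom (H² M) (H² M′) push push-cong
  (λ c d → Quotient.≈⇒∼ (Z² M′) (B² M′) {push (c Z.∙ d)} {push c Z′.∙ push d} (λ g h → homo _ _))
  where
  module Z  = Group (Z² M)
  module Z′ = Group (Z² M′)
  open HModule M′
  open HModuleHom f
  open Cocycle₂
  open IsCoboundary

  push : Cocycle₂ M → Cocycle₂ M′
  push c = record
    { fun = λ g h → ⟦ hom ⟧ (fun c g h)
    ; cong = λ p q → ⟦⟧-cong (cong c p q)
    ; cocycle = λ g h k → trans (∙-congʳ (sym (equivariant g _))) (trans (sym (homo _ _))
        (trans (⟦⟧-cong (cocycle c g h k)) (homo _ _))) }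

  push-cong : ∀ {c d} → IsCoboundary M (c Z.⁻¹ Z.∙ d) → IsCoboundary M′ (push c Z′.⁻¹ Z′.∙ push d)
  push-cong m = record
    { cochain = λ g → ⟦ hom ⟧ (cochain m g)
    ; cong₁ = λ p → ⟦⟧-cong (cong₁ m p)
    ; coboundary = λ g h → trans (trans (∙-congʳ (sym (⁻¹-homo _))) (sym (homo _ _)))
        (trans (⟦⟧-cong (coboundary m g h)) (trans (homo _ _)
          (∙-cong (trans (homo _ _) (∙-congʳ (equivariant g _))) (⁻¹-homo _)))) }

------------------------------------------------------------------------
-- Group extensions 1 → A → E → H → 1 of a finite group by an abelian group

record Extension (H : FiniteGroup) (A : AbelianGroup 0ℓ 0ℓ) : Set₁ where
  private
    module H = FiniteGroup H
    module A = AbelianGroup A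
  field
    E            : Grp
  open Group E
  field
    ι            : Hom A.group E
    p            : Hom E H.group
    ι-injective  : Injective A._≈_ _≈_ ⟦ ι ⟧
    p-surjective : Surjective _≈_ H._≈_ ⟦ p ⟧
    im⊆ker       : ∀ a → ⟦ p ⟧ (⟦ ι ⟧ a) H.≈ H.ε
    ker⊆im       : ∀ {x} → ⟦ p ⟧ x H.≈ H.ε → ∃ λ a → ⟦ ι ⟧ a ≈ x

module ExtensionClass {H : FiniteGroup} {A : AbelianGroup 0ℓ 0ℓ} (ext : Extension H A) where
  private
    module H = FiniteGroup H
    module A = AbelianGroup A
    module enum = Inverse (proj₂ H.finite)
  open Extension ext
  open Group E
  open GroupProperties E
  open SetoidReasoning setoid
  private
    module ι = GroupHomomorphism ι
    module p = GroupHomomorphism p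

  -- Passing through the enumeration of H makes the section respect the
  -- equality of H.
  s : H.Carrier → Carrier
  s h = proj₁ (p-surjective (enum.from (enum.to h)))

  s-cong : ∀ {g h} → g H.≈ h → s g ≈ s h
  s-cong g≈h = reflexive (≡.cong (λ k → proj₁ (p-surjective (enum.from k))) (enum.to-cong g≈h))

  p∘s : ∀ h → ⟦ p ⟧ (s h) H.≈ h
  p∘s h = H.trans (proj₂ (p-surjective (enum.from (enum.to h))) refl) (enum.inverseʳ ≡.refl)

  conj : Carrier → Carrier → Carrier
  conj e x = ⟦ conjugation E e ⟧ x

  conj-ι-∈ker : ∀ e a → ⟦ p ⟧ (conj e (⟦ ι ⟧ a)) H.≈ H.ε
  conj-ι-∈ker e a = NormalSubgroup.conj-closed (kernel E H.group p) e (im⊆ker a)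

  conj-cong : ∀ {e f x y} → e ≈ f → x ≈ y → conj e x ≈ conj f y
  conj-cong e≈f x≈y = ∙-cong (∙-cong e≈f x≈y) (⁻¹-cong e≈f)

  conj-∙ : ∀ e f x → conj (e ∙ f) x ≈ conj e (conj f x)
  conj-∙ e f x = begin
    e ∙ f ∙ x ∙ (e ∙ f) ⁻¹      ≈⟨ ∙-cong (assoc _ _ _) (⁻¹-anti-homo-∙ e f) ⟩
    e ∙ (f ∙ x) ∙ (f ⁻¹ ∙ e ⁻¹) ≈⟨ assoc _ _ _ ⟨
    e ∙ (f ∙ x) ∙ f ⁻¹ ∙ e ⁻¹   ≈⟨ ∙-congʳ (assoc _ _ _) ⟩
    e ∙ (f ∙ x ∙ f ⁻¹) ∙ e ⁻¹   ∎

  conj-ker : ∀ {e} a → ⟦ p ⟧ e H.≈ H.ε → conj e (⟦ ι ⟧ a) ≈ ⟦ ι ⟧ a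
  conj-ker {e} a pe≈ε with u , ιu≈e ← ker⊆im pe≈ε = begin
    e ∙ ⟦ ι ⟧ a ∙ e ⁻¹             ≈⟨ ∙-congʳ (∙-congʳ ιu≈e) ⟨
    ⟦ ι ⟧ u ∙ ⟦ ι ⟧ a ∙ e ⁻¹       ≈⟨ ∙-congʳ (ι.homo u a) ⟨
    ⟦ ι ⟧ (u A.∙ a) ∙ e ⁻¹         ≈⟨ ∙-congʳ (ι.⟦⟧-cong (A.comm u a)) ⟩
    ⟦ ι ⟧ (a A.∙ u) ∙ e ⁻¹         ≈⟨ ∙-congʳ (ι.homo a u) ⟩
    ⟦ ι ⟧ a ∙ ⟦ ι ⟧ u ∙ e ⁻¹       ≈⟨ ∙-congʳ (∙-congˡ ιu≈e) ⟩
    ⟦ ι ⟧ a ∙ e ∙ e ⁻¹             ≈⟨ //-rightDividesʳ e _ ⟩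
    ⟦ ι ⟧ a                        ∎

  conj-fibre : ∀ {e f} a → ⟦ p ⟧ e H.≈ ⟦ p ⟧ f → conj e (⟦ ι ⟧ a) ≈ conj f (⟦ ι ⟧ a)
  conj-fibre {e} {f} a pe≈pf = begin
    conj e (⟦ ι ⟧ a)                 ≈⟨ conj-cong (\\-leftDividesˡ f e) refl ⟨
    conj (f ∙ (f ⁻¹ ∙ e)) (⟦ ι ⟧ a)  ≈⟨ conj-∙ f (f ⁻¹ ∙ e) _ ⟩
    conj f (conj (f ⁻¹ ∙ e) (⟦ ι ⟧ a)) ≈⟨ conj-cong refl (conj-ker a p[f⁻¹e]≈ε) ⟩
    conj f (⟦ ι ⟧ a)                 ∎
    where
    p[f⁻¹e]≈ε : ⟦ p ⟧ (f ⁻¹ ∙ e) H.≈ H.ε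
    p[f⁻¹e]≈ε = H.trans (p.homo _ _) (H.trans (H.∙-cong (p.⁻¹-homo f) pe≈pf) (H.inverseˡ _))

  act : H.Carrier → A.Carrier → A.Carrier
  act h a = proj₁ (ker⊆im (conj-ι-∈ker (s h) a))

  ι-act : ∀ h a → ⟦ ι ⟧ (act h a) ≈ conj (s h) (⟦ ι ⟧ a)
  ι-act h a = proj₂ (ker⊆im (conj-ι-∈ker (s h) a))

  -- h · a = s(h) a s(h)⁻¹, which does not depend on the choice of s.
  hModule : HModule H.group
  hModule = record
    { abelianGroup = A
    ; _·_ = act
    ; ·-cong = λ {g} {h} {a} {b} g≈h a≈b → ι-injective (begin
        ⟦ ι ⟧ (act g a)      ≈⟨ ι-act g a ⟩
        conj (s g) (⟦ ι ⟧ a) ≈⟨ conj-cong (s-cong g≈h) (ι.⟦⟧-cong a≈b) ⟩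
        conj (s h) (⟦ ι ⟧ b) ≈⟨ ι-act h b ⟨
        ⟦ ι ⟧ (act h b)      ∎)
    ; ·-distrib = λ g a b → ι-injective (begin
        ⟦ ι ⟧ (act g (a A.∙ b))          ≈⟨ ι-act g _ ⟩
        conj (s g) (⟦ ι ⟧ (a A.∙ b))     ≈⟨ conj-cong refl (ι.homo a b) ⟩
        conj (s g) (⟦ ι ⟧ a ∙ ⟦ ι ⟧ b)   ≈⟨ GroupHomomorphism.homo (conjugation E (s g)) _ _ ⟩
        conj (s g) (⟦ ι ⟧ a) ∙ conj (s g) (⟦ ι ⟧ b) ≈⟨ ∙-cong (ι-act g a) (ι-act g b) ⟨
        ⟦ ι ⟧ (act g a) ∙ ⟦ ι ⟧ (act g b) ≈⟨ ι.homo _ _ ⟨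
        ⟦ ι ⟧ (act g a A.∙ act g b)      ∎)
    ; ·-unit = λ a → ι-injective (trans (ι-act H.ε a) (conj-ker a (p∘s H.ε)))
    ; ·-assoc = λ g h a → ι-injective (begin
        ⟦ ι ⟧ (act (g H.∙ h) a)           ≈⟨ ι-act _ a ⟩
        conj (s (g H.∙ h)) (⟦ ι ⟧ a)      ≈⟨ conj-fibre a (H.trans (p∘s _)
                                               (H.sym (H.trans (p.homo _ _) (H.∙-cong (p∘s g) (p∘s h))))) ⟩
        conj (s g ∙ s h) (⟦ ι ⟧ a)        ≈⟨ conj-∙ _ _ _ ⟩
        conj (s g) (conj (s h) (⟦ ι ⟧ a)) ≈⟨ conj-cong refl (ι-act h a) ⟨
        conj (s g) (⟦ ι ⟧ (act h a))      ≈⟨ ι-act g _ ⟨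
        ⟦ ι ⟧ (act g (act h a))           ∎) }

  factor : H.Carrier → H.Carrier → Carrier
  factor g h = s g ∙ s h ∙ s (g H.∙ h) ⁻¹

  factor-∈ker : ∀ g h → ⟦ p ⟧ (factor g h) H.≈ H.ε
  factor-∈ker g h = H.trans (p.homo _ _) (H.trans
    (H.∙-cong (H.trans (p.homo _ _) (H.∙-cong (p∘s g) (p∘s h)))
              (H.trans (p.⁻¹-homo _) (H.⁻¹-cong (p∘s _))))
    (H.inverseʳ _))

  c : H.Carrier → H.Carrier → A.Carrier
  c g h = proj₁ (ker⊆im (factor-∈ker g h))

  ι-c : ∀ g h → ⟦ ι ⟧ (c g h) ≈ factor g h
  ι-c g h = proj₂ (ker⊆im (factor-∈ker g h))

  eq₁ : ∀ x y z w v → conj x (y ∙ z ∙ w ⁻¹) ∙ (x ∙ w ∙ v) ≈ x ∙ y ∙ z ∙ v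
  eq₁ x y z w v = begin
    x ∙ (y ∙ z ∙ w ⁻¹) ∙ x ⁻¹ ∙ (x ∙ w ∙ v)   ≈⟨ assoc _ _ _ ⟩
    x ∙ (y ∙ z ∙ w ⁻¹) ∙ (x ⁻¹ ∙ (x ∙ w ∙ v)) ≈⟨ ∙-congˡ (∙-congˡ (assoc x w v)) ⟩
    x ∙ (y ∙ z ∙ w ⁻¹) ∙ (x ⁻¹ ∙ (x ∙ (w ∙ v))) ≈⟨ ∙-congˡ (\\-leftDividesʳ x _) ⟩
    x ∙ (y ∙ z ∙ w ⁻¹) ∙ (w ∙ v)              ≈⟨ ∙-congʳ (assoc x _ _) ⟨
    x ∙ (y ∙ z) ∙ w ⁻¹ ∙ (w ∙ v)              ≈⟨ assoc _ _ _ ⟩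
    x ∙ (y ∙ z) ∙ (w ⁻¹ ∙ (w ∙ v))            ≈⟨ ∙-congˡ (\\-leftDividesʳ w v) ⟩
    x ∙ (y ∙ z) ∙ v                           ≈⟨ ∙-congʳ (assoc x y z) ⟨
    x ∙ y ∙ z ∙ v                             ∎

  eq₂ : ∀ x y z w v → (x ∙ y ∙ w ⁻¹) ∙ (w ∙ z ∙ v) ≈ x ∙ y ∙ z ∙ v
  eq₂ x y z w v = begin
    x ∙ y ∙ w ⁻¹ ∙ (w ∙ z ∙ v)     ≈⟨ ∙-congˡ (assoc w z v) ⟩
    x ∙ y ∙ w ⁻¹ ∙ (w ∙ (z ∙ v))   ≈⟨ assoc _ _ _ ⟩
    x ∙ y ∙ (w ⁻¹ ∙ (w ∙ (z ∙ v))) ≈⟨ ∙-congˡ (\\-leftDividesʳ w _) ⟩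
    x ∙ y ∙ (z ∙ v)                ≈⟨ assoc _ _ _ ⟨
    x ∙ y ∙ z ∙ v                  ∎

  -- The class of the cocycle (g , h) ↦ s(g) s(h) s(gh)⁻¹, which does not
  -- depend on the choice of s.
  extensionClass : Group.Carrier (H² hModule)
  extensionClass = record
    { fun = c
    ; cong = λ {g} {g′} {h} {h′} p q → ι-injective (trans (ι-c g h) (trans
        (∙-cong (∙-cong (s-cong p) (s-cong q)) (⁻¹-cong (s-cong (H.∙-cong p q))))
        (sym (ι-c g′ h′))))
    ; cocycle = λ g h k → ι-injective (begin
        ⟦ ι ⟧ (act g (c h k) A.∙ c g (h H.∙ k))           ≈⟨ ι.homo _ _ ⟩
        ⟦ ι ⟧ (act g (c h k)) ∙ ⟦ ι ⟧ (c g (h H.∙ k))     ≈⟨ ∙-cong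
          (trans (ι-act g _) (conj-cong refl (ι-c h k))) (ι-c g _) ⟩
        conj (s g) (factor h k) ∙ factor g (h H.∙ k)      ≈⟨ eq₁ _ _ _ _ _ ⟩
        s g ∙ s h ∙ s k ∙ s (g H.∙ (h H.∙ k)) ⁻¹          ≈⟨ ∙-congˡ (⁻¹-cong (s-cong (H.assoc g h k))) ⟨
        s g ∙ s h ∙ s k ∙ s (g H.∙ h H.∙ k) ⁻¹            ≈⟨ eq₂ _ _ _ _ _ ⟨
        factor g h ∙ factor (g H.∙ h) k                   ≈⟨ ∙-cong (ι-c g h) (ι-c _ k) ⟨
        ⟦ ι ⟧ (c g h) ∙ ⟦ ι ⟧ (c (g H.∙ h) k)             ≈⟨ ι.homo _ _ ⟨
        ⟦ ι ⟧ (c g h A.∙ c (g H.∙ h) k)                   ≈⟨ ι.⟦⟧-cong (A.comm _ _) ⟩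
        ⟦ ι ⟧ (c (g H.∙ h) k A.∙ c g h)                   ∎) }

------------------------------------------------------------------------
-- The relation module of π : F → H

module RelationModule
  (F : ProfiniteGroup) (H : FiniteGroup)
  (π : ContHom (ProfiniteGroup.top F) (discrete H))
  (π-surjective : Surjective (ProfiniteGroup._≈_ F) (FiniteGroup._≈_ H) (apply π))
  where
  private
    module F = ProfiniteGroup F
    module H = FiniteGroup H
    module π = ContHom π
  open ẐPower F

  ker-π : NormalSubgroup F.group
  ker-π = kernel F.group H.group π.hom

  private module K = NormalSubgroup ker-π

  R : TopGroup
  R = subspace F.top K.subgroup

  [R,R] : NormalSubgroup (TopGroup.group R)
  [R,R] = closedDerived R

  R̄ : TopGroup
  R̄ = quotientSpace R [R,R]

  private
    module R = TopGroup R
    module D = NormalSubgroup [R,R]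

  R̄-abelian : AbelianGroup 0ℓ 0ℓ
  R̄-abelian = record
    { isAbelianGroup = record
      { isGroup = Group.isGroup (TopGroup.group R̄)
      ; comm = λ (x , p) (y , q) i → _ , [ (y , q) , (x , p) ] ,
          Quotient.≈⇒∼ F.group (F.Nbhd i)
            (F.∙-congʳ (F.sym (GroupProperties.⁻¹-anti-homo-∙ F.group x y))) } }

  conj : F.Carrier → ContHom R R
  conj g = restrict F.top K.subgroup
    (record { hom = conjugation F.group g
            ; continuous = λ i → i , NormalSubgroup.conj-closed (F.Nbhd i) g })
    (K.conj-closed g)

  [R,R]-in-F : NormalSubgroup F.group
  [R,R]-in-F = record
    { subgroup = record
      { Mem = λ x → Σ (K.Mem x) λ x∈R → D.Mem (x , x∈R)
      ; resp = λ {x} {y} p (q , m) → K.resp p q , D.resp {x , q} {y , K.resp p q} p m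
      ; ε-closed = K.ε-closed , D.ε-closed
      ; ∙-closed = λ {x} {y} (p , m) (q , n) →
          K.∙-closed p q , D.∙-closed {x , p} {y , q} m n
      ; ⁻¹-closed = λ {x} (p , m) → K.⁻¹-closed p , D.⁻¹-closed {x , p} m }
    ; conj-closed = λ g {x} (p , m) →
        K.conj-closed g p , closedDerived-map R R (conj g) {x , p} m }

  F/[R,R] : Grp
  F/[R,R] = quotientGroup F.group [R,R]-in-F

  π̄-cong : ∀ {x y} → K.Mem (x F.⁻¹ F.∙ y) → apply π x H.≈ apply π y
  π̄-cong {x} {y} q = H.sym (H.trans
    (H.sym (π.⟦⟧-cong (GroupProperties.\\-leftDividesˡ F.group x y)))
    (H.trans (π.homo _ _) (H.trans (H.∙-congˡ q) (H.identityʳ _))))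

  extension : Extension H R̄-abelian
  extension = record
    { E = F/[R,R]
    ; ι = mkHom (TopGroup.group R̄) F/[R,R] proj₁ (λ {x} {y} m → proj₂ (x R.⁻¹ R.∙ y) , m)
        (λ x y → Group.refl F/[R,R] {proj₁ x F.∙ proj₁ y})
    ; p = mkHom F/[R,R] H.group (apply π) (λ (q , _) → π̄-cong q) π.homo
    ; ι-injective = λ {x} {y} (q , m) →
        D.resp {_ , q} {x R.⁻¹ R.∙ y} F.refl m
    ; p-surjective = λ h → let (x , eq) = π-surjective h in
        x , λ (q , _) → H.trans (π̄-cong q) (eq F.refl)
    ; im⊆ker = proj₂
    ; ker⊆im = λ {x} q → (x , q) , Group.refl F/[R,R] {x} }

  open ExtensionClass extension public using () renaming (hModule to R̄-module; extensionClass to β)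

  open HModule R̄-module using (_·_; _∙_; ε; _≈_; setoid; identityʳ)

  π-^ : ∀ {x} → K.Mem x → ∀ n → K.Mem (Power._^_ F.group x n)
  π-^ q ℕ.zero    = K.ε-closed
  π-^ q (ℕ.suc n) = K.∙-closed q (π-^ q n)

  R-^̂ : ∀ {x} → K.Mem x → ∀ z → K.Mem (x ^̂ z)
  R-^̂ {x} q z =
    let (i , N⊆R) = π.continuous tt
        (n , y≈xⁿ) = ^̂-approx x z i
        open Quotient F.group ker-π
    in ∼ε⇒Mem (∼-trans {x ^̂ z} (N⊆R y≈xⁿ) (Mem⇒∼ε (π-^ q n)))

  infixr 8 _·̂_ _⋆_

  _·̂_ : Ẑ → TopGroup.Carrier R̄ → TopGroup.Carrier R̄
  z ·̂ (x , x∈R) = x ^̂ z , R-^̂ x∈R z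

  -- Elements of Ẑ[H] as formal sums of terms z h (repetitions allowed).
  Ẑ[H] : Set
  Ẑ[H] = List (Ẑ × H.Carrier)

  _⋆_ : Ẑ[H] → TopGroup.Carrier R̄ → TopGroup.Carrier R̄
  r ⋆ a = foldr (λ (z , h) b → z ·̂ (h · a) ∙ b) ε r

  -- GL(R̄) is TopAut R̄.
  IsẐ[H]Linear : TopAut R̄ → Set
  IsẐ[H]Linear γ = ∀ r a → apply (TopAut.to γ) (r ⋆ a) ≈ r ⋆ apply (TopAut.to γ) a

  toModuleHom : (γ : TopAut R̄) → IsẐ[H]Linear γ → HModuleHom R̄-module R̄-module
  toModuleHom γ linear = record
    { hom = ContHom.hom to
    ; equivariant = λ h a → begin
        apply to (h · a)                ≈⟨ ContHom.⟦⟧-cong to {((1̂ , h) ∷ []) ⋆ a} {h · a} (1̂h⋆ h a) ⟨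
        apply to (((1̂ , h) ∷ []) ⋆ a)  ≈⟨ linear ((1̂ , h) ∷ []) a ⟩
        ((1̂ , h) ∷ []) ⋆ apply to a    ≈⟨ 1̂h⋆ h (apply to a) ⟩
        h · apply to a                  ∎ }
    where
    open TopAut γ using (to)
    open SetoidReasoning setoid
    1̂h⋆ : ∀ h a → ((1̂ , h) ∷ []) ⋆ a ≈ h · a
    1̂h⋆ h a = begin
      1̂ ·̂ (h · a) ∙ ε ≈⟨ identityʳ (1̂ ·̂ (h · a)) ⟩
      1̂ ·̂ (h · a)     ≈⟨ Quotient.≈⇒∼ R.group [R,R] {1̂ ·̂ (h · a)} {h · a} (^̂-1̂ (proj₁ (h · a))) ⟩
      h · a            ∎

  record A[π] : Set where
    field
      aut : TopAut F.top
      π∘α : ∀ x → apply π (apply (TopAut.to aut) x) H.≈ apply π x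

  ρ : A[π] → TopAut R̄
  ρ α = record
    { to = toᴿ
    ; from = fromᴿ
    ; invˡ = λ x → Quotient.≈⇒∼ R.group [R,R] {apply toᴿ (apply fromᴿ x)} {x} (invˡ (proj₁ x))
    ; invʳ = λ x → Quotient.≈⇒∼ R.group [R,R] {apply fromᴿ (apply toᴿ x)} {x} (invʳ (proj₁ x)) }
    where
    open A[π] α
    open TopAut aut
    to-R : ∀ {x} → K.Mem x → K.Mem (apply to x)
    to-R {x} q = H.trans (π∘α x) q
    from-R : ∀ {x} → K.Mem x → K.Mem (apply from x)
    from-R {x} q = H.trans (H.sym (π∘α _)) (H.trans (π.⟦⟧-cong (invˡ x)) q)
    induced : (f : ContHom F.top F.top) → (∀ {x} → K.Mem x → K.Mem (apply f x)) → ContHom R̄ R̄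
    induced f f-R = descend R [R,R] fᴿ (λ {x} → closedDerived-map R R fᴿ {x})
      where fᴿ = restrict F.top K.subgroup f f-R
    toᴿ   = induced to to-R
    fromᴿ = induced from from-R

  Image-ρ : Pred (TopAut R̄) 0ℓ
  Image-ρ γ = ∃ λ α → ρ α ≈Aut γ

  Aut[H,β] : Pred (TopAut R̄) 0ℓ
  Aut[H,β] γ = Σ (IsẐ[H]Linear γ) λ linear →
    Group._≈_ (H² R̄-module) (⟦ H²-map (toModuleHom γ linear) ⟧ β) β

{-# OPTIONS --safe #-}

-- For γ preserving β, a cochain trivialising γ_*(β) − β extends γ to an
-- automorphism θ of F/[R,R] over H, and θ has to be lifted to F.  Let Lₙ be the
-- intersection of the kernels of all homomorphisms F → Sₙ (suitably
-- reindexed): a cofinal sequence of fully invariant open subgroups.  Suppose α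
-- is an endomorphism of F that induces θ on F/[R,R] and an automorphism of
-- F/Lₙ.  Since F/([R,R] ∩ Lₙ) → F/[R,R] has a finite kernel, α is also onto
-- modulo [R,R] ∩ Lₙ, so by Gaschütz's lemma for F/Lₙ₊₁ the images of the
-- generators can be changed inside [R,R] ∩ Lₙ to make α an automorphism modulo
-- Lₙ₊₁.  The limit of this sequence of endomorphisms is an automorphism of F
-- inducing γ.  Everything is decided in finite quotients, so no compactness
-- argument is needed.
module Submission where

open import Defs
open import Algebra.Bundles using (Group)
open import Algebra.Morphism.Bundles using (GroupHomomorphism)
import Algebra.Properties.CommutativeMonoid.Sum as SumProperties
import Algebra.Properties.Group as GroupProperties
import Algebra.Solver.CommutativeMonoid as CommutativeMonoidSolver
open import Data.Bool.Base using (Bool; true; false; if_then_else_; not) renaming (_∧_ to _&&_; _∨_ to _||_)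
import Data.Bool.Properties as Bool
open import Data.Fin.Base as Fin using (Fin; zero; suc; toℕ)
open import Data.Fin.Permutation as Perm using (Permutation′; permutation; _⟨$⟩ʳ_; _⟨$⟩ˡ_; lift₀; _∘ₚ_)
import Data.Fin.Properties as Fin
open import Data.List.Base as List using (List; []; _∷_)
open import Data.List.Membership.Propositional.Properties using (∈-lookup)
import Data.List.Membership.Setoid.Properties as ∈
import Data.List.Relation.Unary.All as All
import Data.List.Relation.Unary.AllPairs.Core as AllPairs
open import Data.List.Relation.Unary.Any as Any using (Any)
open import Data.List.Relation.Unary.Unique.DecSetoid.Properties using (deduplicate-!)
import Data.List.Relation.Unary.Unique.Setoid as Unique
open import Data.Nat.Base as ℕ using (ℕ; _≤_; _<_)
import Data.Nat.Properties as ℕ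
open import Data.Product.Base using (Σ; ∃; _×_; _,_; proj₁; proj₂)
open import Data.Sum.Base using (_⊎_; inj₁; inj₂; [_,_]′)
open import Data.Unit.Base using (⊤; tt)
open import Function.Base using (_∘_; id)
open import Function.Bundles using (Inverse)
open import Function.Definitions using (Surjective)
open import Level using (0ℓ)
open import Relation.Binary.Bundles using (Setoid; DecSetoid)
open import Relation.Binary.Definitions using () renaming (Decidable to Decidable₂)
open import Relation.Binary.PropositionalEquality as ≡ using (_≡_; _≢_)
import Relation.Binary.Reasoning.Setoid as SetoidReasoning
open import Relation.Nullary.Decidable using (Dec; yes; no; does; map′; _×-dec_; _⊎-dec_; ¬?; dec-true; decidable-stable)
open import Relation.Nullary.Negation using (contradiction)
open import Relation.Unary using (Pred; Decidable; _⊆_; _≐_)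

-- Finite setoids

-- `Index` is only a directed type, whereas the lifts are improved one stage after another. The
-- symmetric groups provide a tower indexed by ℕ inside every F, and its members are open because a
-- homomorphism to a finite group is one of finitely many d-tuples. The closed subgroup [R,R] is
-- neither open nor decidable. It is approached by the open subgroups [R,R]Lₙ, where membership is
-- decided by saturating a finite subset. Gaschütz's lemma is a count: the number of lifts of a
-- tuple to F/V that generate F/V is the same for all tuples that generate F/N. The usual proof
-- subtracts from all lifts those that generate proper subgroups, by induction over subgroups. Here
-- a tuple stands for the subgroup that it generates, so the induction runs over down-sets of a
-- finite preorder of tuples. The free generators are a generating lift of themselves, hence the
-- count is not zero.

Finite-dec : (S : Setoid 0ℓ 0ℓ) → Finite S → Decidable₂ (Setoid._≈_ S)
Finite-dec S (n , S↔n) x y = map′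
  (λ eq → trans (sym (inverseʳ ≡.refl)) (inverseʳ eq)) to-cong (to x Fin.≟ to y)
  where
  open Setoid S
  open Inverse S↔n

abstract
  -- `Finite` asks for a bijection with some `Fin n`. Listing the values of a surjection and
  -- deleting repetitions, which takes decidable equality, produces one.
  Finite-cover : (S : Setoid 0ℓ 0ℓ) → Decidable₂ (Setoid._≈_ S) →
                 ∀ {n} (e : Fin n → Setoid.Carrier S) →
                 (∀ s → ∃ λ i → Setoid._≈_ S (e i) s) → Finite S
  Finite-cover S _≟_ {n} e covers = List.length xs , record
    { to = λ s → Any.index (∈xs s)
    ; from = List.lookup xs
    ; to-cong = λ {s} {t} s≈t → lookup-injective (deduplicate-! decSetoid (List.tabulate e))
        (trans (sym (index-lookup (∈xs s))) (trans s≈t (index-lookup (∈xs t))))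
    ; from-cong = λ { ≡.refl → refl }
    ; inverse = (λ { {i} {y} p → lookup-injective (deduplicate-! decSetoid (List.tabulate e))
                       (trans (sym (index-lookup (∈xs y))) p) })
              , (λ { {s} ≡.refl → sym (index-lookup (∈xs s)) }) }
    where
    open Setoid S
    decSetoid : DecSetoid 0ℓ 0ℓ
    decSetoid = record { isDecEquivalence = record { isEquivalence = isEquivalence ; _≟_ = _≟_ } }
    xs : List Carrier
    xs = List.deduplicate _≟_ (List.tabulate e)
    ∈xs : ∀ s → Any (s ≈_) xs
    ∈xs s = ∈.∈-deduplicate⁺ S _≟_ (λ q p → trans p (sym q))
      (∈.∈-resp-≈ S (proj₂ (covers s)) (∈.∈-tabulate⁺ S (proj₁ (covers s))))
    index-lookup : ∀ {s ys} (p : Any (s ≈_) ys) → s ≈ List.lookup ys (Any.index p)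
    index-lookup (Any.here p)  = p
    index-lookup (Any.there p) = index-lookup p
    lookup-injective : ∀ {ys} → Unique.Unique S ys → ∀ {i j} →
                       List.lookup ys i ≈ List.lookup ys j → i ≡ j
    lookup-injective (p AllPairs.∷ u) {zero}  {zero}  eq = ≡.refl
    lookup-injective (p AllPairs.∷ u) {zero}  {suc j} eq = contradiction eq (All.lookup p (∈-lookup j))
    lookup-injective (p AllPairs.∷ u) {suc i} {zero}  eq = contradiction (sym eq) (All.lookup p (∈-lookup i))
    lookup-injective (p AllPairs.∷ u) {suc i} {suc j} eq = ≡.cong suc (lookup-injective u eq)

tuples : ℕ → Setoid 0ℓ 0ℓ → Setoid 0ℓ 0ℓ
tuples d S = record
  { Carrier = Fin d → Carrier
  ; _≈_ = λ s t → ∀ k → s k ≈ t k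
  ; isEquivalence = record
    { refl = λ _ → refl ; sym = λ p k → sym (p k) ; trans = λ p q k → trans (p k) (q k) } }
  where open Setoid S

abstract
  Finite-tuples : ∀ d (S : Setoid 0ℓ 0ℓ) → Finite S → Finite (tuples d S)
  Finite-tuples d S fin@(n , S↔n) =
    Finite-cover (tuples d S) (λ s t → Fin.all? (λ k → Finite-dec S fin (s k) (t k)))
      (λ i k → from (Fin.finToFun {n} {d} i k))
      (λ s → Fin.funToFin (to ∘ s) , λ k →
        inverseʳ (Fin.finToFun-funToFin (to ∘ s) k))
    where open Inverse S↔n

module _ (S : Setoid 0ℓ 0ℓ) (fin : Finite S) where
  open Setoid S
  open Inverse (proj₂ fin)

  private
    from-to : ∀ s → from (to s) ≈ s
    from-to s = inverseʳ ≡.refl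

    to-from : ∀ i → to (from i) ≡ i
    to-from i = inverseˡ refl

  Finite-any? : {P : Pred Carrier 0ℓ} → (∀ {s t} → s ≈ t → P s → P t) →
                Decidable P → Dec (∃ P)
  Finite-any? P-resp P? = map′ (λ (i , p) → from i , p)
    (λ (s , p) → to s , P-resp (sym (from-to s)) p) (Fin.any? (P? ∘ from))

  Finite-all? : {P : Pred Carrier 0ℓ} → (∀ {s t} → s ≈ t → P s → P t) →
                Decidable P → Dec (∀ s → P s)
  Finite-all? P-resp P? = map′ (λ f s → P-resp (from-to s) (f (to s)))
    (λ f i → f (from i)) (Fin.all? (P? ∘ from))

  permute : (f g : Carrier → Carrier) → (∀ {s t} → s ≈ t → f s ≈ f t) →
            (∀ {s t} → s ≈ t → g s ≈ g t) → (∀ s → f (g s) ≈ s) → (∀ s → g (f s) ≈ s) →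
            Permutation′ (proj₁ fin)
  permute f g f-cong g-cong fg gf = permutation (to ∘ f ∘ from) (to ∘ g ∘ from)
    (λ i → ≡.trans (to-cong (trans (f-cong (from-to _)) (fg _))) (to-from i))
    (λ i → ≡.trans (to-cong (trans (g-cong (from-to _)) (gf _))) (to-from i))

  -- A missed `t` together with the values of `f` would be one element too many for the pigeonhole
  -- principle.
  Finite-injective⇒surjective : (f : Carrier → Carrier) → (∀ {s t} → s ≈ t → f s ≈ f t) →
    (∀ {s t} → f s ≈ f t → s ≈ t) → ∀ t → ∃ λ s → f s ≈ t
  Finite-injective⇒surjective f f-cong f-inj t
    with Finite-any? (λ s≈s′ p → trans (f-cong (sym s≈s′)) p) (λ s → Finite-dec S fin (f s) t)
  ... | yes p = p
  ... | no ¬p with Fin.pigeonhole (ℕ.n<1+n _) g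
    where
    g : Fin (ℕ.suc (proj₁ fin)) → Fin (proj₁ fin)
    g zero    = to t
    g (suc i) = to (f (from i))
  ...   | zero  , suc j , _ , eq = contradiction (from j , trans (sym (from-to _)) (inverseʳ (≡.sym eq))) ¬p
  ...   | suc i , suc j , i<j , eq = contradiction
          (≡.trans (≡.sym (to-from i)) (≡.trans
            (to-cong (f-inj (trans (sym (from-to _)) (inverseʳ eq)))) (to-from j)))
          (λ i≡j → ℕ.<⇒≢ i<j (≡.cong (toℕ ∘ suc) i≡j))

-- Counting in finite preorders

private
  module ∑ = SumProperties ℕ.+-0-commutativeMonoid

mass : ∀ {n} → (Fin n → Bool) → (Fin n → ℕ) → ℕ
mass P u = ∑.sum (λ i → if P i then u i else 0)

mass-cong : ∀ {n} {P Q : Fin n → Bool} {u v : Fin n → ℕ} →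
            (∀ i → (if P i then u i else 0) ≡ (if Q i then v i else 0)) → mass P u ≡ mass Q v
mass-cong eq = ∑.sum-cong-≗ eq

mass-split : ∀ {n} (P Q : Fin n → Bool) u →
             mass P u ≡ mass (λ i → P i && Q i) u ℕ.+ mass (λ i → P i && not (Q i)) u
mass-split P Q u = ≡.trans (∑.sum-cong-≗ split) (∑.∑-distrib-+
    (λ i → if P i && Q i then u i else 0) (λ i → if P i && not (Q i) then u i else 0))
  where
  split : ∀ i → (if P i then u i else 0) ≡
    (if P i && Q i then u i else 0) ℕ.+ (if P i && not (Q i) then u i else 0)
  split i with P i | Q i
  ... | false | _     = ≡.refl
  ... | true  | true  = ≡.sym (ℕ.+-identityʳ _)
  ... | true  | false = ≡.refl

mass-∈ : ∀ {n} (P : Fin n → Bool) u {a} → P a ≡ true → u a ≤ mass P u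
mass-∈ P u {zero} Pa rewrite Pa = ℕ.m≤m+n _ _
mass-∈ P u {suc a} Pa = ℕ.≤-trans (mass-∈ (P ∘ suc) (u ∘ suc) Pa) (ℕ.m≤n+m _ _)

mass≢0 : ∀ {n} (P : Fin n → Bool) u → mass P u ≢ 0 → ∃ λ a → P a ≡ true × u a ≢ 0
mass≢0 {n} P u m≢0 with Fin.any? (λ a → (P a Bool.≟ true) ×-dec ¬? (u a ℕ.≟ 0))
... | yes p = p
... | no ¬p = contradiction (≡.trans (∑.sum-cong-≗ zeros) (∑.sum-replicate-zero n)) m≢0
  where
  zeros : ∀ a → (if P a then u a else 0) ≡ 0
  zeros a with P a in Pa
  ... | false = ≡.refl
  ... | true  = decidable-stable (u a ℕ.≟ 0) (λ ua≢0 → ¬p (a , Pa , ua≢0))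

card : ∀ {n} → (Fin n → Bool) → ℕ
card P = mass P (λ _ → 1)

abstract
  -- The witnesses i are added to Q one at a time.
  least-closure-dec : ∀ {n} {P : Pred (Fin n) 0ℓ} →
    ((Q : Fin n → Bool) → (∀ {i} → Q i ≡ true → P i) →
      (∀ {i} → P i → Q i ≡ true) ⊎ ∃ λ i → P i × Q i ≡ false) → Decidable P
  least-closure-dec {n} {P} grow = go (card {n} (λ _ → true)) (λ _ → false) (λ ()) ℕ.≤-refl
    where
    go : ∀ m (Q : Fin n → Bool) → (∀ {i} → Q i ≡ true → P i) → card (not ∘ Q) ≤ m → Decidable P
    go m Q Q⊆P ≤m with grow Q Q⊆P
    ... | inj₁ P⊆Q = λ i → map′ Q⊆P P⊆Q (Q i Bool.≟ true)
    go ℕ.zero Q Q⊆P ≤m | inj₂ (a , Pa , Qa) =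
      contradiction (ℕ.≤-trans (mass-∈ (not ∘ Q) (λ _ → 1) {a} (≡.cong not Qa)) ≤m) (λ ())
    go (ℕ.suc m) Q Q⊆P ≤m | inj₂ (a , Pa , Qa) = go m Q′ Q′⊆P (ℕ.s≤s⁻¹ (ℕ.≤-trans
        (ℕ.≤-trans (ℕ.+-mono-≤ (mass-∈ (λ i → not (Q i) && does (i Fin.≟ a)) (λ _ → 1) {a} a∈)
          (ℕ.≤-reflexive (mass-cong {P = not ∘ Q′} {λ i → not (Q i) && not (does (i Fin.≟ a))} {λ _ → 1} {λ _ → 1} eq)))
          (ℕ.≤-reflexive (≡.sym (mass-split (not ∘ Q) (λ i → does (i Fin.≟ a)) (λ _ → 1))))) ≤m))
      where
      Q′ : Fin n → Bool
      Q′ i = Q i || does (i Fin.≟ a)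
      Q′⊆P : ∀ {i} → Q′ i ≡ true → P i
      Q′⊆P {i} q with Q i in Qi | i Fin.≟ a
      ... | true  | _          = Q⊆P Qi
      ... | false | yes ≡.refl = Pa
      a∈ : not (Q a) && does (a Fin.≟ a) ≡ true
      a∈ rewrite Qa | dec-true (a Fin.≟ a) ≡.refl = ≡.refl
      eq : ∀ i → (if not (Q′ i) then 1 else 0) ≡ (if not (Q i) && not (does (i Fin.≟ a)) then 1 else 0)
      eq i with Q i | i Fin.≟ a
      ... | true  | _ = ≡.refl
      ... | false | _ = ≡.refl

argmax : ∀ {n} {P : Pred (Fin n) 0ℓ} → Decidable P → (μ : Fin n → ℕ) → ∃ P →
         ∃ λ a → P a × ∀ {b} → P b → μ b ≤ μ a
argmax {ℕ.suc n} {P} P? μ (a , Pa) with Fin.any? (P? ∘ suc)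
argmax P? μ (zero  , Pa) | no ¬p = zero , Pa , λ
  { {zero} _ → ℕ.≤-refl ; {suc i} p → contradiction (i , p) ¬p }
argmax P? μ (suc a , Pa) | no ¬p = contradiction (a , Pa) ¬p
... | yes p with b , Pb , max ← argmax (P? ∘ suc) (μ ∘ suc) p
            with P? zero | ℕ.≤-total (μ zero) (μ (suc b))
...   | yes P0 | inj₂ ≥ = zero , P0 , λ { {zero} _ → ℕ.≤-refl ; {suc i} q → ℕ.≤-trans (max q) ≥ }
...   | yes P0 | inj₁ ≤ = suc b , Pb , λ { {zero} _ → ≤ ; {suc i} q → max q }
...   | no ¬P0 | _      = suc b , Pb , λ { {zero} q → contradiction q ¬P0 ; {suc i} q → max q }

-- If u and v have the same mass on all principal down-sets generated by a
-- point of their support, then they have the same mass on all down-sets P: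
-- remove from P the up-set of a maximal point a of the support in P; what is
-- removed is, up to points of mass 0, the difference of two smaller down-sets.
module DownSets {n : ℕ} (_⊑_ : Fin n → Fin n → Bool)
  (⊑-refl : ∀ a → a ⊑ a ≡ true)
  (⊑-trans : ∀ {a b c} → a ⊑ b ≡ true → b ⊑ c ≡ true → a ⊑ c ≡ true)
  (u v : Fin n → ℕ)
  (principal : ∀ a → u a ≢ 0 ⊎ v a ≢ 0 → mass (_⊑ a) u ≡ mass (_⊑ a) v)
  where

  IsDownSet : (Fin n → Bool) → Set
  IsDownSet P = ∀ {a b} → a ⊑ b ≡ true → P b ≡ true → P a ≡ true

  private
    _∖↑_ : (Fin n → Bool) → Fin n → Fin n → Bool
    (P ∖↑ a) i = P i && not (a ⊑ i)

    ∖↑-down : ∀ {P} → IsDownSet P → ∀ a → IsDownSet (P ∖↑ a)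
    ∖↑-down {P} down a {i} {j} i⊑j p with P j in Pj | a ⊑ j in a⊑j
    ... | true | false rewrite down {i} {j} i⊑j Pj with a ⊑ i in a⊑i
    ...   | false = ≡.refl
    ...   | true  = ≡.trans (≡.sym a⊑j) (⊑-trans a⊑i i⊑j)

    ∖↑-< : ∀ (P : Fin n → Bool) {a} → P a ≡ true → card (P ∖↑ a) < card P
    ∖↑-< P {a} Pa = ℕ.≤-trans (ℕ.+-monoˡ-≤ (card (P ∖↑ a))
        (mass-∈ (λ i → P i && (a ⊑ i)) (λ _ → 1) {a} a∈))
        (ℕ.≤-reflexive (≡.sym (mass-split P (a ⊑_) (λ _ → 1))))
      where
      a∈ : P a && (a ⊑ a) ≡ true
      a∈ rewrite Pa = ⊑-refl a

    mass-∩ : ∀ (P Q : Fin n → Bool) (f : Fin n → ℕ) → (∀ {i} → Q i ≡ true → P i ≡ true) →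
             mass (λ i → P i && Q i) f ≡ mass Q f
    mass-∩ P Q f Q⊆P = mass-cong {P = λ i → P i && Q i} {Q} {f} {f} eq
      where
      eq : ∀ i → (if P i && Q i then f i else 0) ≡ (if Q i then f i else 0)
      eq i with Q i in Qi
      ... | true rewrite Q⊆P Qi = ≡.refl
      ... | false rewrite Bool.∧-zeroʳ (P i) = ≡.refl

    mass-⊆ : ∀ (P Q : Fin n → Bool) (f : Fin n → ℕ) → (∀ {i} → Q i ≡ true → P i ≡ true) → mass Q f ≤ mass P f
    mass-⊆ P Q f Q⊆P = ℕ.≤-trans (ℕ.≤-reflexive (≡.sym (mass-∩ P Q f Q⊆P)))
      (ℕ.≤-trans (ℕ.m≤m+n _ _) (ℕ.≤-reflexive (≡.sym (mass-split P Q f))))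

  Supported : Pred (Fin n) 0ℓ
  Supported a = u a ≢ 0 ⊎ v a ≢ 0

  private
    supported? : Decidable Supported
    supported? a = ¬? (u a ℕ.≟ 0) ⊎-dec ¬? (v a ℕ.≟ 0)

    find : ∀ P → mass P u ≡ mass P v ⊎ ∃ λ a → P a ≡ true × Supported a
    find P with mass P u ℕ.≟ 0 | mass P v ℕ.≟ 0
    ... | yes p | yes q = inj₁ (≡.trans p (≡.sym q))
    ... | no p  | _     = let (a , Pa , ua) = mass≢0 P u p in inj₂ (a , Pa , inj₁ ua)
    ... | _     | no q  = let (a , Pa , va) = mass≢0 P v q in inj₂ (a , Pa , inj₂ va)

    go : ∀ m P → IsDownSet P → card P < m → mass P u ≡ mass P v
    go (ℕ.suc m) P down <m with find P
    ... | inj₁ eq = eq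
    -- A supported point of `P` with the largest down-set is maximal in the preorder, so a
    -- comparison of sizes finds one.
    ... | inj₂ p with a , (Pa , wa) , max ← argmax (λ i → (P i Bool.≟ true) ×-dec supported? i)
                                              (λ i → card (_⊑ i)) p = begin
      mass P u                                          ≡⟨ mass-split P (a ⊑_) u ⟩
      mass (λ i → P i && (a ⊑ i)) u ℕ.+ mass (P ∖↑ a) u ≡⟨ ≡.cong₂ ℕ._+_ class (go m (P ∖↑ a)
                                                           (∖↑-down {P} down a) (ℕ.<-≤-trans (∖↑-< P Pa) (ℕ.s≤s⁻¹ <m))) ⟩
      mass (λ i → P i && (a ⊑ i)) v ℕ.+ mass (P ∖↑ a) v ≡⟨ mass-split P (a ⊑_) v ⟨
      mass P v                                          ∎
      where
      open ≡.≡-Reasoning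
      ↓a⊆P : ∀ {i} → i ⊑ a ≡ true → P i ≡ true
      ↓a⊆P i⊑a = down i⊑a Pa
      maximal : ∀ {b} → P b ≡ true → Supported b → a ⊑ b ≡ true → b ⊑ a ≡ true
      maximal {b} Pb wb a⊑b with b ⊑ a in b⊑a
      ... | true  = ≡.refl
      ... | false = contradiction (ℕ.<-≤-trans less (max (Pb , wb))) (ℕ.<-irrefl ≡.refl)
        where
        less : card (_⊑ a) < card (_⊑ b)
        less = ℕ.≤-trans (ℕ.≤-reflexive (ℕ.+-comm 1 _)) (ℕ.≤-trans (ℕ.+-mono-≤
          (ℕ.≤-reflexive (≡.sym (mass-∩ (_⊑ b) (_⊑ a) (λ _ → 1) (λ i⊑a → ⊑-trans i⊑a a⊑b))))
          (mass-∈ (λ i → (i ⊑ b) && not (i ⊑ a)) (λ _ → 1) {b} b∈))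
          (ℕ.≤-reflexive (≡.sym (mass-split (_⊑ b) (_⊑ a) (λ _ → 1)))))
          where
          b∈ : (b ⊑ b) && not (b ⊑ a) ≡ true
          b∈ rewrite b⊑a = ≡.trans (Bool.∧-identityʳ _) (⊑-refl b)
      -- By maximality the points of `P` above `a` that are not equivalent to `a` carry no mass.
      class≡ : ∀ f → (∀ i → f i ≢ 0 → Supported i) →
               mass (λ i → P i && (a ⊑ i)) f ≡ mass (λ i → (i ⊑ a) && (a ⊑ i)) f
      class≡ f supp = mass-cong {P = λ i → P i && (a ⊑ i)} {λ i → (i ⊑ a) && (a ⊑ i)} {f} {f} eq
        where
        eq : ∀ i → (if P i && (a ⊑ i) then f i else 0) ≡ (if (i ⊑ a) && (a ⊑ i) then f i else 0)
        eq i with a ⊑ i in a⊑i | i ⊑ a in i⊑a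
        ... | false | b rewrite Bool.∧-zeroʳ (P i) | Bool.∧-zeroʳ b = ≡.refl
        ... | true  | true rewrite ↓a⊆P i⊑a = ≡.refl
        ... | true  | false with P i in Pi | f i ℕ.≟ 0
        ...   | false | _      = ≡.refl
        ...   | true  | yes eq = eq
        ...   | true  | no neq = contradiction (≡.trans (≡.sym i⊑a) (maximal Pi (supp i neq) a⊑i)) (λ ())
      below : mass ((_⊑ a) ∖↑ a) u ≡ mass ((_⊑ a) ∖↑ a) v
      below = go m ((_⊑ a) ∖↑ a) (∖↑-down {_⊑ a} ⊑-trans a) (ℕ.<-≤-trans (∖↑-< (_⊑ a) (⊑-refl a))
        (ℕ.≤-trans (mass-⊆ P (_⊑ a) (λ _ → 1) ↓a⊆P) (ℕ.s≤s⁻¹ <m)))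
      class : mass (λ i → P i && (a ⊑ i)) u ≡ mass (λ i → P i && (a ⊑ i)) v
      class = begin
        mass (λ i → P i && (a ⊑ i)) u       ≡⟨ class≡ u (λ _ → inj₁) ⟩
        mass (λ i → (i ⊑ a) && (a ⊑ i)) u   ≡⟨ ℕ.+-cancelʳ-≡ (mass ((_⊑ a) ∖↑ a) u) _ _ (begin
          mass (λ i → (i ⊑ a) && (a ⊑ i)) u ℕ.+ mass ((_⊑ a) ∖↑ a) u ≡⟨ mass-split (_⊑ a) (a ⊑_) u ⟨
          mass (_⊑ a) u                                                ≡⟨ principal a wa ⟩
          mass (_⊑ a) v                                                ≡⟨ mass-split (_⊑ a) (a ⊑_) v ⟩
          mass (λ i → (i ⊑ a) && (a ⊑ i)) v ℕ.+ mass ((_⊑ a) ∖↑ a) v ≡⟨ ≡.cong (_ ℕ.+_) below ⟨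
          mass (λ i → (i ⊑ a) && (a ⊑ i)) v ℕ.+ mass ((_⊑ a) ∖↑ a) u ∎) ⟩
        mass (λ i → (i ⊑ a) && (a ⊑ i)) v   ≡⟨ class≡ v (λ _ → inj₂) ⟨
        mass (λ i → P i && (a ⊑ i)) v       ∎

  mass-down : ∀ P → IsDownSet P → mass P u ≡ mass P v
  mass-down P down = go (ℕ.suc (card P)) P down ℕ.≤-refl

  -- Below a top element lies everything, and what is not above it forms a down-set: subtract
  -- `mass-down` from `principal`.
  mass-up : ∀ t → Supported t → (∀ a → a ⊑ t ≡ true) → mass (t ⊑_) u ≡ mass (t ⊑_) v
  mass-up t wt top = ℕ.+-cancelʳ-≡ (mass ((_⊑ t) ∖↑ t) u) _ _ (begin
    mass (t ⊑_) u ℕ.+ mass ((_⊑ t) ∖↑ t) u                      ≡⟨ ≡.cong (ℕ._+ mass ((_⊑ t) ∖↑ t) u) (mass-∩ (_⊑ t) (t ⊑_) u (λ _ → top _)) ⟨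
    mass (λ i → (i ⊑ t) && (t ⊑ i)) u ℕ.+ mass ((_⊑ t) ∖↑ t) u ≡⟨ mass-split (_⊑ t) (t ⊑_) u ⟨
    mass (_⊑ t) u                                                ≡⟨ principal t wt ⟩
    mass (_⊑ t) v                                                ≡⟨ mass-split (_⊑ t) (t ⊑_) v ⟩
    mass (λ i → (i ⊑ t) && (t ⊑ i)) v ℕ.+ mass ((_⊑ t) ∖↑ t) v ≡⟨ ≡.cong₂ ℕ._+_
      (mass-∩ (_⊑ t) (t ⊑_) v (λ _ → top _)) (≡.sym (mass-down ((_⊑ t) ∖↑ t) (∖↑-down {_⊑ t} ⊑-trans t))) ⟩
    mass (t ⊑_) v ℕ.+ mass ((_⊑ t) ∖↑ t) u                      ∎)
    where open ≡.≡-Reasoning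

module _ (S : Setoid 0ℓ 0ℓ) (fin : Finite S) where
  open Setoid S

  module _
    {_⊑_ : Carrier → Carrier → Set} (_⊑?_ : Decidable₂ _⊑_)
    (⊑-reflexive : ∀ {a b} → a ≈ b → a ⊑ b)
    (⊑-trans : ∀ {a b c} → a ⊑ b → b ⊑ c → a ⊑ c)
    {X Y : Pred Carrier 0ℓ} (X-resp : ∀ {a b} → a ≈ b → X a → X b)
    (Y-resp : ∀ {a b} → a ≈ b → Y a → Y b) (X? : Decidable X) (Y? : Decidable Y)
    (translate : ∀ a → X a ⊎ Y a → ∃ λ (φ : Inverse S S) →
      (∀ {b} → X b → b ⊑ a → Y (Inverse.to φ b) × Inverse.to φ b ⊑ a) ×
      (∀ {b} → Y b → b ⊑ a → X (Inverse.from φ b) × Inverse.from φ b ⊑ a))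
    where
    private
      open Inverse (proj₂ fin)

      from-to : ∀ a → from (to a) ≈ a
      from-to a = inverseʳ ≡.refl

      le : Fin (proj₁ fin) → Fin (proj₁ fin) → Bool
      le i j = does (from i ⊑? from j)

      le⇒⊑ : ∀ {i j} → le i j ≡ true → from i ⊑ from j
      le⇒⊑ {i} {j} p with from i ⊑? from j
      ... | yes q = q

      ⊑⇒le : ∀ {i j} → from i ⊑ from j → le i j ≡ true
      ⊑⇒le {i} {j} p = dec-true (from i ⊑? from j) p

      δ : {A : Set} → Dec A → ℕ
      δ a? = if does a? then 1 else 0

      δ≢0 : {A : Set} (a? : Dec A) → δ a? ≢ 0 → A
      δ≢0 (yes a) _ = a
      δ≢0 (no _)  p = contradiction ≡.refl p

      -- The masses are the indicator functions of X and Y. Since φ carries the points of X below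
      -- `from i` onto those of Y, it reindexes one sum as the other.
      principal : ∀ i → δ (X? (from i)) ≢ 0 ⊎ δ (Y? (from i)) ≢ 0 →
                  mass (λ j → le j i) (λ j → δ (X? (from j))) ≡
                  mass (λ j → le j i) (λ j → δ (Y? (from j)))
      principal i p with φ , fwd , bwd ← translate (from i)
                           ([ inj₁ ∘ δ≢0 (X? (from i)) , inj₂ ∘ δ≢0 (Y? (from i)) ]′ p) =
        ≡.trans (mass-cong {P = λ j → le j i} {λ j → le (π ⟨$⟩ʳ j) i}
                   {λ j → δ (X? (from j))} {λ j → δ (Y? (from (π ⟨$⟩ʳ j)))} eq)
          (≡.sym (∑.sum-permute (λ j → if le j i then δ (Y? (from j)) else 0) π))
        where
        module φ = Inverse φ
        π : Permutation′ (proj₁ fin)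
        π = permute S fin φ.to φ.from φ.to-cong φ.from-cong
          (λ _ → φ.inverseˡ refl) (λ _ → φ.inverseʳ refl)
        eq : ∀ j → (if le j i then δ (X? (from j)) else 0) ≡
                   (if le (π ⟨$⟩ʳ j) i then δ (Y? (from (π ⟨$⟩ʳ j))) else 0)
        eq j with from j ⊑? from i | X? (from j) | from (to (φ.to (from j))) ⊑? from i
                  | Y? (from (to (φ.to (from j))))
        ... | yes _ | yes _ | yes _ | yes _ = ≡.refl
        ... | yes p | yes q | no ¬r | _     =
          contradiction (⊑-trans (⊑-reflexive (from-to _)) (proj₂ (fwd q p))) ¬r
        ... | yes p | yes q | yes _ | no ¬r = contradiction (Y-resp (sym (from-to _)) (proj₁ (fwd q p))) ¬r
        ... | yes _ | no _  | no _  | _     = ≡.refl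
        ... | yes _ | no _  | yes _ | no _  = ≡.refl
        ... | no _  | _     | no _  | _     = ≡.refl
        ... | no _  | _     | yes _ | no _  = ≡.refl
        ... | yes _ | no ¬r | yes p | yes q = contradiction (X-resp back (proj₁ (bwd q p))) ¬r
          where back = φ.inverseʳ (from-to _)
        ... | no ¬r | _     | yes p | yes q =
          contradiction (⊑-trans (⊑-reflexive (sym back)) (proj₂ (bwd q p))) ¬r
          where back = φ.inverseʳ (from-to _)

    abstract
      -- By `mass-up` there are as many points of Y as of X above the top element `t`, and `t` is
      -- itself one of the latter.
      exists-above : ∀ t → X t → (∀ a → a ⊑ t) → ∃ λ y → Y y × t ⊑ y
      exists-above t Xt top =
        let (y , t⊑y , Yy) = mass≢0 (le (to t)) (λ j → δ (Y? (from j)))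
              (λ eq → ℕ.n≮0 (ℕ.≤-trans 1≤ (ℕ.≤-reflexive (≡.trans
                (mass-up (to t) (inj₁ λ eq → ℕ.n≮0 (ℕ.≤-reflexive (≡.trans (≡.sym δt) eq)))
                  (λ i → ⊑⇒le (⊑-trans (top (from i)) (⊑-reflexive (sym (from-to t)))))) eq))))
        in from y , δ≢0 (Y? (from y)) Yy , ⊑-trans (⊑-reflexive (sym (from-to t))) (le⇒⊑ t⊑y)
        where
        open DownSets le (λ a → ⊑⇒le (⊑-reflexive refl))
          (λ p q → ⊑⇒le (⊑-trans (le⇒⊑ p) (le⇒⊑ q)))
          (λ j → δ (X? (from j))) (λ j → δ (Y? (from j))) principal
        δt : δ (X? (from (to t))) ≡ 1
        δt rewrite dec-true (X? (from (to t))) (X-resp (sym (from-to t)) Xt) = ≡.refl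
        1≤ : 1 ≤ mass (le (to t)) (λ j → δ (X? (from j)))
        1≤ = ℕ.≤-trans (ℕ.≤-reflexive (≡.sym δt))
          (mass-∈ (le (to t)) (λ j → δ (X? (from j))) {to t} (⊑⇒le (⊑-reflexive refl)))

-- Symmetric groups

Sym : ℕ → FiniteGroup
Sym n = record { group = group ; finite = Finite-cover (Group.setoid group) _≟_ enumerate covers }
  where
  group : Grp
  group = record
    { Carrier = Permutation′ n
    ; _≈_ = Perm._≈_
    -- `∘ₚ` composes in diagrammatic order; the swap makes `⟨$⟩ʳ` a left action.
    ; _∙_ = λ π ρ → ρ ∘ₚ π
    ; ε = Perm.id
    ; _⁻¹ = Perm.flip
    ; isGroup = record
      { isMonoid = record
        { isSemigroup = record
          { isMagma = record
            { isEquivalence = record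
              { refl = λ _ → ≡.refl ; sym = λ p i → ≡.sym (p i) ; trans = λ p q i → ≡.trans (p i) (q i) }
            ; ∙-cong = λ {π} p q i → ≡.trans (≡.cong (π ⟨$⟩ʳ_) (q i)) (p _) }
          ; assoc = λ _ _ _ _ → ≡.refl }
        ; identity = (λ _ _ → ≡.refl) , (λ _ _ → ≡.refl) }
      ; inverse = (λ π _ → Perm.inverseˡ π) , (λ π _ → Perm.inverseʳ π)
      ; ⁻¹-cong = λ {π} {ρ} p i → ≡.trans (≡.cong (π ⟨$⟩ˡ_) (≡.sym (≡.trans (p _) (Perm.inverseʳ ρ))))
          (Perm.inverseˡ π) } }

  _≟_ : Decidable₂ (Perm._≈_ {n} {n})
  π ≟ ρ = Fin.all? (λ i → (π ⟨$⟩ʳ i) Fin.≟ (ρ ⟨$⟩ʳ i))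

  -- Pairs (f , g) that are not mutually inverse are sent to the identity.
  mk : (f g : Fin n → Fin n) → Permutation′ n
  mk f g with Fin.all? (λ i → f (g i) Fin.≟ i) | Fin.all? (λ i → g (f i) Fin.≟ i)
  ... | yes p | yes q = permutation f g p q
  ... | _     | _     = Perm.id

  mk-≈ : ∀ {f g} (π : Permutation′ n) → (∀ i → f i ≡ π ⟨$⟩ʳ i) → (∀ i → g i ≡ π ⟨$⟩ˡ i) → mk f g Perm.≈ π
  mk-≈ {f} {g} π f≗π g≗π with Fin.all? (λ i → f (g i) Fin.≟ i) | Fin.all? (λ i → g (f i) Fin.≟ i)
  ... | yes p | yes q = f≗π
  ... | yes _ | no ¬q = contradiction (λ i → ≡.trans (g≗π _)
    (≡.trans (≡.cong (π ⟨$⟩ˡ_) (f≗π i)) (Perm.inverseˡ π))) ¬q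
  ... | no ¬p | _     = contradiction (λ i → ≡.trans (f≗π _)
    (≡.trans (≡.cong (π ⟨$⟩ʳ_) (g≗π i)) (Perm.inverseʳ π))) ¬p

  decode : Fin (n ℕ.^ n) × Fin (n ℕ.^ n) → Permutation′ n
  decode (i , j) = mk (Fin.finToFun i) (Fin.finToFun j)

  enumerate : Fin (n ℕ.^ n ℕ.* n ℕ.^ n) → Permutation′ n
  enumerate k = decode (Fin.remQuot (n ℕ.^ n) k)

  covers : ∀ π → ∃ λ k → enumerate k Perm.≈ π
  covers π = Fin.combine i j , λ a → ≡.trans
      (≡.cong (λ ij → decode ij ⟨$⟩ʳ a) (Fin.remQuot-combine i j))
      (mk-≈ π (Fin.finToFun-funToFin _) (Fin.finToFun-funToFin _) a)
    where
    i = Fin.funToFin (π ⟨$⟩ʳ_)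
    j = Fin.funToFin (π ⟨$⟩ˡ_)

discreteProfinite : FiniteGroup → ProfiniteGroup
discreteProfinite H = record
  { top = discrete H
  ; finite = λ _ → proj₁ H.finite , record
    { to = to ; from = from ; to-cong = to-cong ∘ ⁻¹∙≈ε⇒≈ ; from-cong = λ { ≡.refl → inverseˡ _ }
    ; inverse = (inverse-to ∘ ⁻¹∙≈ε⇒≈) , (λ p → ≈⇒⁻¹∙≈ε (inverseʳ′ p)) }
  ; separated = λ p → ⁻¹∙≈ε⇒≈ (p tt)
  ; complete = λ x _ → x tt , λ _ → inverseˡ _ }
  where
  module H = FiniteGroup H
  open FiniteGroup H using (_≈_; _∙_; _⁻¹; ε; inverseˡ)
  open Inverse (proj₂ H.finite) using (to; from; to-cong; from-cong) renaming (inverseˡ to inverse-to; inverseʳ to inverseʳ′)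
  ⁻¹∙≈ε⇒≈ : ∀ {x y} → x ⁻¹ ∙ y ≈ ε → x ≈ y
  ⁻¹∙≈ε⇒≈ {x} {y} p = H.trans (H.sym (H.identityʳ x)) (H.trans (H.∙-congˡ (H.sym p))
    (GroupProperties.\\-leftDividesˡ H.group x y))
  ≈⇒⁻¹∙≈ε : ∀ {x y} → x ≈ y → x ⁻¹ ∙ y ≈ ε
  ≈⇒⁻¹∙≈ε p = H.trans (H.∙-congˡ (H.sym p)) (inverseˡ _)

-- Open subgroups of a free profinite group

module OpenSubgroups (F : ProfiniteGroup) where
  open ProfiniteGroup F

  -- Containing a basic subgroup does not decide membership constructively. Decidability is a
  -- separate field because the quotient is a `Finite` setoid, and can be searched, only with it.
  record OpenNormal : Set₁ where
    field
      normal : NormalSubgroup group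
      open?  : ∃ λ i → ⟨ Nbhd i ⟩ ⊆ ⟨ normal ⟩
      _∈?    : Decidable ⟨ normal ⟩

    open Quotient group normal public hiding (group)
    open NormalSubgroup normal public using (Mem)

    setoid/ : Setoid 0ℓ 0ℓ
    setoid/ = Group.setoid (quotientGroup group normal)

    abstract
      finite/ : Finite setoid/
      finite/ = Finite-cover setoid/ (λ _ _ → _ ∈?) I.from
          (λ s → I.to s , i⊆ (I.inverseʳ ≡.refl))
        where
        i : Index
        i = proj₁ open?
        i⊆ : ⟨ Nbhd i ⟩ ⊆ ⟨ normal ⟩
        i⊆ = proj₂ open?
        module I = Inverse (proj₂ (finite i))

    finiteGroup/ : FiniteGroup
    finiteGroup/ = record { group = quotientGroup group normal ; finite = finite/ }

  bound : ∀ {n} (j : Fin n → Index) → ∃ λ k → ∀ a → ⟨ Nbhd k ⟩ ⊆ ⟨ Nbhd (j a) ⟩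
  bound {ℕ.zero}  j = inhabited , λ ()
  bound {ℕ.suc n} j =
    let (k , k⊆)      = bound (j ∘ suc)
        (l , l⊆ , l⊆k) = directed (j zero) k
    in l , λ { zero → l⊆ ; (suc a) → λ m → k⊆ a (l⊆k m) }

module FreeProfinite (F : ProfiniteGroup) {d : ℕ} (x : Fin d → ProfiniteGroup.Carrier F)
  (free : IsFreeProfinite F x) where
  open ProfiniteGroup F
  open OpenSubgroups F

  module _ (G : FiniteGroup) where
    private module G = FiniteGroup G

    finiteHom : (Fin d → G.Carrier) → ContHom top (discrete G)
    finiteHom g = proj₁ (free (discreteProfinite G) g)

    finiteHom-x : ∀ g k → apply (finiteHom g) (x k) G.≈ g k
    finiteHom-x g = proj₁ (proj₂ (free (discreteProfinite G) g))

    finite-unique : (f g : ContHom top (discrete G)) → (∀ k → apply f (x k) G.≈ apply g (x k)) →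
                    ∀ y → apply f y G.≈ apply g y
    finite-unique f g eq y = G.trans (unique f eq y) (G.sym (unique g (λ _ → G.refl) y))
      where unique = proj₂ (proj₂ (free (discreteProfinite G) (apply g ∘ x)))

  endo : (Fin d → Carrier) → ContHom top top
  endo y = proj₁ (free F y)

  endo-x : ∀ y k → apply (endo y) (x k) ≈ y k
  endo-x y = proj₁ (proj₂ (free F y))

  -- Open, because a homomorphism is determined by the images of the generators.
  residual : FiniteGroup → OpenNormal
  residual G = record
    { normal = record
      { subgroup = record
        { Mem = λ z → (f : ContHom top (discrete G)) → apply f z G.≈ G.ε
        ; resp = λ p m f → ker.resp f p (m f)
        ; ε-closed = λ f → ker.ε-closed f
        ; ∙-closed = λ p q f → ker.∙-closed f (p f) (q f)
        ; ⁻¹-closed = λ p f → ker.⁻¹-closed f (p f) }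
      ; conj-closed = λ g p f → ker.conj-closed f g (p f) }
    ; open? = k , λ {z} z∈k f → G.trans (h-unique f _ (λ j → G.sym (I.inverseʳ ≡.refl j)) z)
        (proj₂ (ContHom.continuous (h (I.from (I.to (apply f ∘ x)))) tt) (k⊆ (I.to (apply f ∘ x)) z∈k))
    ; _∈? = λ z → map′
        (λ p f → G.trans (h-unique f (apply f ∘ x) (λ _ → G.refl) z) (p (apply f ∘ x)))
        (λ p g → p (h g))
        (Finite-all? tuple fin
          (λ {s} {t} s≈t p → G.trans (h-unique (h t) s (λ j → G.trans (finiteHom-x G t j) (G.sym (s≈t j))) z) p)
          (λ g → Finite-dec G.setoid G.finite (apply (h g) z) G.ε)) }
    where
    module G = FiniteGroup G
    module ker (f : ContHom top (discrete G)) =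
      NormalSubgroup (kernel group G.group (ContHom.hom f))
    tuple : Setoid 0ℓ 0ℓ
    tuple = tuples d G.setoid
    fin : Finite tuple
    fin = Finite-tuples d G.setoid G.finite
    module I = Inverse (proj₂ fin)
    h : (Fin d → G.Carrier) → ContHom top (discrete G)
    h = finiteHom G
    h-unique : ∀ f g → (∀ k → apply f (x k) G.≈ g k) → ∀ z → apply f z G.≈ apply (h g) z
    h-unique f g eq = finite-unique G f (h g) λ k → G.trans (eq k) (G.sym (finiteHom-x G g k))
    b = bound (λ i → proj₁ (ContHom.continuous (h (I.from i)) tt))
    k = proj₁ b
    k⊆ = proj₂ b

  K : ℕ → OpenNormal
  K n = residual (Sym n)

  -- `g ∘ f` is again a homomorphism to `Sym n`, and `z` is killed by all of these.
  K-invariant : ∀ n (f : ContHom top top) {z} → OpenNormal.Mem (K n) z → OpenNormal.Mem (K n) (apply f z)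
  K-invariant n f z∈K g = z∈K (record
    { hom = mkHom group S.group (λ z → apply g (apply f z))
        (λ {y} {z} p → ContHom.⟦⟧-cong g (ContHom.⟦⟧-cong f p))
        (λ y z → S.trans {apply g (apply f (y ∙ z))} {apply g (apply f y ∙ apply f z)} {apply g (apply f y) S.∙ apply g (apply f z)}
          (ContHom.⟦⟧-cong g (ContHom.homo f y z)) (ContHom.homo g _ _))
    ; continuous = λ j → let (i , c) = ContHom.continuous g j
                             (i′ , c′) = ContHom.continuous f i
                         in i′ , λ z∈ → c (c′ z∈) })
    where module S = FiniteGroup (Sym n)

  -- `lift₀` embeds `Sym n` in `Sym (suc n)` as the stabiliser of `zero`.
  K-suc : ∀ n {z} → OpenNormal.Mem (K (ℕ.suc n)) z → OpenNormal.Mem (K n) z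
  K-suc n z∈K f i = Fin.suc-injective (z∈K (record
    { hom = mkHom group (FiniteGroup.group (Sym (ℕ.suc n))) (λ z → lift₀ (apply f z))
        (λ {y} {z} p → lift-cong {apply f y} {apply f z} (ContHom.⟦⟧-cong f p))
        (λ { y z zero → ≡.refl ; y z (suc i) → ≡.cong suc (ContHom.homo f y z i) })
    ; continuous = λ j → let (i , c) = ContHom.continuous f j in
        i , λ {z} z∈ → λ { zero → ≡.refl ; (suc i) → ≡.cong suc (c z∈ i) } }) (suc i))
    where
    lift-cong : ∀ {π ρ : Permutation′ n} → π Perm.≈ ρ → lift₀ π Perm.≈ lift₀ ρ
    lift-cong p zero    = ≡.refl
    lift-cong p (suc i) = ≡.cong suc (p i)

  K-antitone : ∀ {m n} → m ≤ n → ∀ {z} → OpenNormal.Mem (K n) z → OpenNormal.Mem (K m) z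
  K-antitone {m} m≤n z∈K with ℕ.≤⇒≤′ m≤n
  ... | ℕ.≤′-reflexive ≡.refl = z∈K
  ... | ℕ.≤′-step m≤′n        = K-antitone (ℕ.≤′⇒≤ m≤′n) (K-suc _ z∈K)

  -- Cayley's theorem for F/Uᵢ.
  K-cofinal : ∀ i {z} → OpenNormal.Mem (K (proj₁ (finite i))) z → ⟨ Nbhd i ⟩ z
  K-cofinal i {z} z∈K = ∼ε⇒Mem (∼-trans (≈⇒∼ (sym (identityʳ z)))
    (∼-trans (∼-sym (from-to (z ∙ ε))) (∼-trans (≡.subst (λ j → I.from (I.to (z ∙ ε)) ∼ I.from j) to[z∙ε]≡to[ε] (≈⇒∼ refl)) (from-to ε))))
    where
    open Quotient group (Nbhd i) hiding (group)
    module I = Inverse (proj₂ (finite i))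
    from-to : ∀ y → I.from (I.to y) ∼ y
    from-to y = I.inverseʳ ≡.refl
    n = proj₁ (finite i)
    act : Carrier → Permutation′ n
    act g = permute (Group.setoid (quotient i)) (finite i) (g ∙_) (g ⁻¹ ∙_)
      (∼-∙-cong (≈⇒∼ refl)) (∼-∙-cong (≈⇒∼ refl))
      (λ y → ≈⇒∼ (GroupProperties.\\-leftDividesˡ group g y))
      (λ y → ≈⇒∼ (GroupProperties.\\-leftDividesʳ group g y))
    act-cong : ∀ {g h} → g ∼ h → act g Perm.≈ act h
    act-cong p a = I.to-cong (∼-∙-cong p (≈⇒∼ refl))
    regular : ContHom top (discrete (Sym n))
    regular = record
      { hom = mkHom group (FiniteGroup.group (Sym n)) act (λ p → act-cong (≈⇒∼ p))
          (λ g h a → I.to-cong (∼-trans (≈⇒∼ (assoc g h _))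
            (∼-∙-cong (≈⇒∼ (refl {g})) (∼-sym (from-to _)))))
      ; continuous = λ _ → i , λ {g} g∈ a → ≡.trans (act-cong (Mem⇒∼ε g∈) a)
          (≡.trans (I.to-cong (≈⇒∼ (identityˡ _))) (I.inverseˡ (≈⇒∼ refl))) }
    to[z∙ε]≡to[ε] : I.to (z ∙ ε) ≡ I.to ε
    to[z∙ε]≡to[ε] = ≡.trans (I.to-cong (∼-∙-cong (≈⇒∼ (refl {z})) (∼-sym (from-to ε)))) (z∈K regular (I.to ε))

-- Gaschütz's lemma for finite quotients of F

module Gaschütz (F : ProfiniteGroup) {d : ℕ} (x : Fin d → ProfiniteGroup.Carrier F)
  (free : IsFreeProfinite F x) where
  open ProfiniteGroup F
  open OpenSubgroups F
  open FreeProfinite F x free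
  open GroupProperties group using (//-rightDividesˡ; //-rightDividesʳ)

  idHom : ContHom top top
  idHom = record { hom = mkHom group group id id (λ _ _ → refl) ; continuous = λ i → i , id }

  infixr 9 _∘ʰ_
  _∘ʰ_ : ContHom top top → ContHom top top → ContHom top top
  f ∘ʰ g = record
    { hom = mkHom group group (apply f ∘ apply g) (λ p → ContHom.⟦⟧-cong f (ContHom.⟦⟧-cong g p))
        (λ y z → trans (ContHom.⟦⟧-cong f (ContHom.homo g y z)) (ContHom.homo f _ _))
    ; continuous = λ i → let (j , c) = ContHom.continuous f i
                             (k , c′) = ContHom.continuous g j in k , λ z∈ → c (c′ z∈) }

  Invariant : OpenNormal → Set
  Invariant V = (f : ContHom top top) → ∀ {z} → OpenNormal.Mem V z → OpenNormal.Mem V (apply f z)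

  module _ (V : OpenNormal) where
    open OpenNormal V

    -- Freeness gives uniqueness for homomorphisms into the finite group F/V, so `g` has to be a
    -- homomorphism only modulo V. This form applies to θ, which respects products only modulo
    -- [R,R].
    unique-mod : (f : ContHom top top) (g : Carrier → Carrier) →
      (∀ {y z} → y ≈ z → g y ∼ g z) → (∀ y z → g (y ∙ z) ∼ g y ∙ g z) →
      (∃ λ i → ∀ {z} → ⟨ Nbhd i ⟩ z → Mem (g z)) →
      (∀ k → apply f (x k) ∼ g (x k)) → ∀ z → apply f z ∼ g z
    unique-mod f g g-cong g-homo (i , g-cont) = finite-unique finiteGroup/
        (modulo (apply f) (λ p → ≈⇒∼ (ContHom.⟦⟧-cong f p)) (λ y z → ≈⇒∼ (ContHom.homo f y z))
          (let (j , j⊆)     = open?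
               (k , f-cont) = ContHom.continuous f j
           in k , λ z∈ → j⊆ (f-cont z∈)))
        (modulo g g-cong g-homo (i , g-cont))
      where
      modulo : (g : Carrier → Carrier) → (∀ {y z} → y ≈ z → g y ∼ g z) → (∀ y z → g (y ∙ z) ∼ g y ∙ g z) →
               (∃ λ i → ∀ {z} → ⟨ Nbhd i ⟩ z → Mem (g z)) → ContHom top (discrete finiteGroup/)
      modulo g g-cong g-homo (i , g-cont) = record
        { hom = mkHom group (FiniteGroup.group finiteGroup/) g g-cong g-homo
        ; continuous = λ _ → i , λ z∈ → Mem⇒∼ε (g-cont z∈) }

    unique-endo-mod : (f g : ContHom top top) → (∀ k → apply f (x k) ∼ apply g (x k)) →
                      ∀ z → apply f z ∼ apply g z
    unique-endo-mod f g = unique-mod f (apply g)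
      (λ p → ≈⇒∼ (ContHom.⟦⟧-cong g p)) (λ y z → ≈⇒∼ (ContHom.homo g y z))
      (let (i , i⊆)     = open?
           (j , g-cont) = ContHom.continuous g i
       in j , λ z∈ → i⊆ (g-cont z∈))

    invariant-cong : Invariant V → (f : ContHom top top) → ∀ {y z} → y ∼ z → apply f y ∼ apply f z
    invariant-cong V-inv f {y} {z} p = NormalSubgroup.resp normal (trans (ContHom.homo f _ _) (∙-congʳ (ContHom.⁻¹-homo f y))) (V-inv f p)

  -- Gaschütz's lemma for F/V → F/N.  A subgroup B of F/V contains as many of the
  -- lifts X of (xₖ) as of the lifts Y of (α(xₖ)): none unless BN = F, and
  -- otherwise a coset of (B ∩ N)ᵈ of either kind.
  module _ (V : OpenNormal) (V-inv : Invariant V) (N : OpenNormal)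
    (V⊆N : ∀ {z} → OpenNormal.Mem V z → OpenNormal.Mem N z)
    (α : ContHom top top) (α-surjective : ∀ z → ∃ λ w → OpenNormal._∼_ N (apply α w) z) where
    private
      module V = OpenNormal V
      module N = OpenNormal N

      tuple : Setoid 0ℓ 0ℓ
      tuple = tuples d V.setoid/

      -- The subgroup of F/V generated by the tuple `a`. As the image of `endo a` it is decided by a
      -- search over F/V, the invariance of V making `endo a` act there.
      Im : (Fin d → Carrier) → Pred Carrier 0ℓ
      Im a z = ∃ λ w → apply (endo a) w V.∼ z

      Im? : ∀ a → Decidable (Im a)
      Im? a z = Finite-any? V.setoid/ V.finite/
        (λ p → V.∼-trans (invariant-cong V V-inv (endo a) (V.∼-sym p))) (λ w → _ V.∈?)

      Im-∙ : ∀ a {y z} → Im a y → Im a z → Im a (y ∙ z)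
      Im-∙ a (u , p) (v , q) = u ∙ v , V.∼-trans (V.≈⇒∼ (ContHom.homo (endo a) u v)) (V.∼-∙-cong p q)

      Im-⁻¹ : ∀ a {y} → Im a y → Im a (y ⁻¹)
      Im-⁻¹ a (u , p) = u ⁻¹ , V.∼-trans (V.≈⇒∼ (ContHom.⁻¹-homo (endo a) u)) (V.∼-⁻¹-cong p)

      infix 4 _⊑_
      _⊑_ : (Fin d → Carrier) → (Fin d → Carrier) → Set
      b ⊑ a = ∀ k → Im a (b k)

      -- If `v` consists of preimages of `b` under `endo a`, then `endo a ∘ endo v` and `endo b`
      -- agree modulo V on the generators, hence everywhere.
      ⊑-Im : ∀ {a b} → b ⊑ a → ∀ {z} → Im b z → Im a z
      ⊑-Im {a} {b} b⊑a {z} (w , p) = apply (endo v) w , V.∼-trans (unique-endo-mod V (endo a ∘ʰ endo v) (endo b)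
          (λ k → V.∼-trans (V.≈⇒∼ (ContHom.⟦⟧-cong (endo a) (endo-x v k)))
            (V.∼-trans (proj₂ (b⊑a k)) (V.≈⇒∼ (sym (endo-x b k))))) w) p
        where v = λ k → proj₁ (b⊑a k)

      X Y : Pred (Fin d → Carrier) 0ℓ
      X y = ∀ k → y k N.∼ x k
      Y y = ∀ k → y k N.∼ apply α (x k)

      -- Right multiplication by `p⁻¹ q` moves the coset of lifts containing `p` to the one
      -- containing `q` without leaving the subgroup generated by `a`; exchanging `p` and `q`
      -- inverts it.
      module Translate (a p q : Fin d → Carrier) (p⊑a : p ⊑ a) (q⊑a : q ⊑ a) where
        to : (Fin d → Carrier) → Fin d → Carrier
        to y k = y k ∙ p k ⁻¹ ∙ q k

        to-⊑ : ∀ {b} → b ⊑ a → to b ⊑ a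
        to-⊑ b⊑a k = Im-∙ a (Im-∙ a (b⊑a k) (Im-⁻¹ a (p⊑a k))) (q⊑a k)

        to-∼ : ∀ {r s : Fin d → Carrier} → (∀ k → p k N.∼ r k) → (∀ k → q k N.∼ s k) →
               ∀ {b : Fin d → Carrier} → (∀ k → b k N.∼ r k) → ∀ k → to b k N.∼ s k
        to-∼ {r} p∼r q∼s b∼r k = N.∼-trans (N.∼-∙-cong (N.∼-∙-cong (b∼r k) (N.∼-⁻¹-cong (p∼r k))) (q∼s k))
          (N.≈⇒∼ (trans (∙-congʳ (inverseʳ (r k))) (identityˡ _)))

      translation : ∀ a p q → p ⊑ a → q ⊑ a → X p → Y q → ∃ λ (φ : Inverse tuple tuple) →
        (∀ {b} → X b → b ⊑ a → Y (Inverse.to φ b) × Inverse.to φ b ⊑ a) ×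
        (∀ {b} → Y b → b ⊑ a → X (Inverse.from φ b) × Inverse.from φ b ⊑ a)
      translation a p q p⊑a q⊑a Xp Yq = record
          { to = pq.to ; from = qp.to
          ; to-cong = λ r k → V.∼-∙-cong (V.∼-∙-cong (r k) (V.≈⇒∼ refl)) (V.≈⇒∼ refl)
          ; from-cong = λ r k → V.∼-∙-cong (V.∼-∙-cong (r k) (V.≈⇒∼ refl)) (V.≈⇒∼ refl)
          ; inverse = (λ r k → V.∼-trans (V.∼-∙-cong (V.∼-∙-cong (r k) (V.≈⇒∼ refl)) (V.≈⇒∼ refl))
                                          (V.≈⇒∼ (cancel _ (q k) (p k))))
                    , (λ r k → V.∼-trans (V.∼-∙-cong (V.∼-∙-cong (r k) (V.≈⇒∼ refl)) (V.≈⇒∼ refl))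
                                          (V.≈⇒∼ (cancel _ (p k) (q k)))) }
        , (λ Xb b⊑a → pq.to-∼ Xp Yq Xb , pq.to-⊑ b⊑a)
        , (λ Yb b⊑a → qp.to-∼ Yq Xp Yb , qp.to-⊑ b⊑a)
        where
        module pq = Translate a p q p⊑a q⊑a
        module qp = Translate a q p q⊑a p⊑a
        cancel : ∀ y s t → y ∙ s ⁻¹ ∙ t ∙ t ⁻¹ ∙ s ≈ y
        cancel y s t = trans (∙-congʳ (//-rightDividesʳ t _)) (//-rightDividesˡ s y)

      ∈-⊑ : ∀ a k → Im a (apply (endo a) k)
      ∈-⊑ a k = k , V.≈⇒∼ refl

      self : ∀ a → a ⊑ a
      self a k = x k , V.≈⇒∼ (endo-x a k)

      -- A translation needs a lift of either kind in the subgroup generated by `a`. If `a` lifts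
      -- the generators, `endo a` is the identity modulo N and sends `α (x k)` to a lift of itself.
      -- If `a` lifts their images, `endo a` is α modulo N, and preimages of the generators under α
      -- yield the other lift.
      translate : ∀ a → X a ⊎ Y a → ∃ λ (φ : Inverse tuple tuple) →
        (∀ {b} → X b → b ⊑ a → Y (Inverse.to φ b) × Inverse.to φ b ⊑ a) ×
        (∀ {b} → Y b → b ⊑ a → X (Inverse.from φ b) × Inverse.from φ b ⊑ a)
      translate a (inj₁ Xa) = translation a a (λ k → apply (endo a) (apply α (x k))) (self a)
        (λ k → ∈-⊑ a _) Xa
        (λ k → unique-endo-mod N (endo a) idHom (λ k → N.∼-trans (N.≈⇒∼ (endo-x a k)) (Xa k)) (apply α (x k)))
      translate a (inj₂ Ya) = translation a (λ k → apply (endo a) (proj₁ (α-surjective (x k)))) a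
        (λ k → ∈-⊑ a _) (self a)
        (λ k → N.∼-trans (unique-endo-mod N (endo a) α (λ k → N.∼-trans (N.≈⇒∼ (endo-x a k)) (Ya k)) _)
                         (proj₂ (α-surjective (x k)))) Ya

    abstract
      -- The top element is `x`, which generates F/V and is a lift of itself. A tuple `y` above it
      -- is one whose generated subgroup contains all `x k`.
      gaschütz : ∃ λ y → (∀ k → y k N.∼ apply α (x k)) × (∀ k → ∃ λ w → apply (endo y) w V.∼ x k)
      gaschütz = exists-above tuple (Finite-tuples d V.setoid/ V.finite/)
        (λ b a → Fin.all? (λ k → Im? a (b k)))
        (λ {a} {b} p k → x k , V.∼-trans (V.≈⇒∼ (endo-x b k)) (V.∼-sym (p k)))
        (λ {a} {b} {c} a⊑b b⊑c k → ⊑-Im {c} {b} b⊑c (a⊑b k))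
        {X} {Y} (λ p Xa k → N.∼-trans (N.∼-sym (V⊆N (p k))) (Xa k))
        (λ p Ya k → N.∼-trans (N.∼-sym (V⊆N (p k))) (Ya k))
        (λ a → Fin.all? (λ k → _ N.∈?)) (λ a → Fin.all? (λ k → _ N.∈?))
        translate x (λ k → N.≈⇒∼ refl)
        (λ a k → a k , unique-endo-mod V (endo x) idHom (λ k → V.≈⇒∼ (endo-x x k)) (a k))

-- Deciding membership in [S,S]N for a subgroup S containing N

module _ (G : Grp) (N : NormalSubgroup G) (fin : Finite (Group.setoid (quotientGroup G N)))
  (S : Subgroup G) (S? : Decidable (Subgroup.Mem S)) (N⊆S : ⟨ N ⟩ ⊆ Subgroup.Mem S) where
  private
    open Group G
    open Quotient G N hiding (group)
    module S = Subgroup S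
    module I = Inverse (proj₂ fin)
    m = proj₁ fin

    C : Pred Carrier 0ℓ
    C z = ∃ λ a → Σ (S.Mem a) (λ p → Commutators (subgroupGroup G S) (a , p)) × a ∼ z

    C-resp : ∀ {y z} → y ∼ z → C y → C z
    C-resp p (a , m , q) = a , m , ∼-trans q p

    S-resp : ∀ {y z} → y ∼ z → S.Mem y → S.Mem z
    S-resp {y} {z} p y∈S = S.resp (GroupProperties.\\-leftDividesˡ G y z) (S.∙-closed y∈S (N⊆S p))

    from-to : ∀ z → I.from (I.to z) ∼ z
    from-to z = I.inverseʳ ≡.refl

    comm : Carrier → Carrier → Carrier
    comm y z = (y ⁻¹ ∙ z ⁻¹) ∙ (y ∙ z)

    module Grow (Q : Fin m → Bool) (Q⊆C : ∀ {i} → Q i ≡ true → C (I.from i)) where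
      Counterexample : Set
      Counterexample = ∃ λ i → C (I.from i) × Q i ≡ false

      missing : ∀ {z} → C z → Q (I.to z) ≡ false → Counterexample
      missing {z} c q = I.to z , C-resp (∼-sym (from-to z)) c , q

      unit? : Dec (Q (I.to ε) ≡ false)
      unit? = Q (I.to ε) Bool.≟ false

      comm? : Dec (∃ λ i → ∃ λ j → S.Mem (I.from i) × S.Mem (I.from j) ×
                   Q (I.to (comm (I.from i) (I.from j))) ≡ false)
      comm? = Fin.any? λ i → Fin.any? λ j → S? (I.from i) ×-dec S? (I.from j) ×-dec (Q _ Bool.≟ false)

      ∙? : Dec (∃ λ i → ∃ λ j → Q i ≡ true × Q j ≡ true × Q (I.to (I.from i ∙ I.from j)) ≡ false)
      ∙? = Fin.any? λ i → Fin.any? λ j → (Q i Bool.≟ true) ×-dec (Q j Bool.≟ true) ×-dec (Q _ Bool.≟ false)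

      ⁻¹? : Dec (∃ λ i → Q i ≡ true × Q (I.to (I.from i ⁻¹)) ≡ false)
      ⁻¹? = Fin.any? λ i → (Q i Bool.≟ true) ×-dec (Q _ Bool.≟ false)

      transport : ∀ {y z} → y ∼ z → Q (I.to y) ≡ true → Q (I.to z) ≡ true
      transport p Qy = ≡.trans (≡.cong Q (I.to-cong (∼-sym p))) Qy

      -- Derivations in `Commutators` cannot be searched, but closure of the finite set `Q` can be
      -- tested. A failure exhibits a new element of `C`; without failure, induction on derivations
      -- (`generated`) puts all of `C` into `Q`.
      grow : (∀ {i} → C (I.from i) → Q i ≡ true) ⊎ Counterexample
      grow with unit? | comm? | ∙? | ⁻¹?
      ... | yes q | _ | _ | _ =
        inj₂ (missing (ε , (S.ε-closed , unit) , ≈⇒∼ refl) q)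
      ... | _ | yes (i , j , p , p′ , q) | _ | _ =
        inj₂ (missing (_ , (_ , [ (I.from i , p) , (I.from j , p′) ]) , ≈⇒∼ refl) q)
      ... | _ | _ | yes (i , j , p , p′ , q) | _ =
        let (a , (a∈S , c) , r) = Q⊆C p
            (a′ , (a′∈S , c′) , r′) = Q⊆C p′
        in inj₂ (missing (_ , (_ , mul c c′) , ∼-∙-cong r r′) q)
      ... | _ | _ | _ | yes (i , p , q) =
        let (a , (a∈S , c) , r) = Q⊆C p
        in inj₂ (missing (_ , (_ , inv c) , ∼-⁻¹-cong r) q)
      ... | no ¬unit | no ¬comm | no ¬∙ | no ¬⁻¹ = inj₁ λ {i} (a , (a∈S , c) , p) →
          ≡.subst (λ j → Q j ≡ true) (I.inverseˡ (≈⇒∼ refl)) (transport p (generated c))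
        where
        generated : ∀ {u} → Commutators (subgroupGroup G S) u → Q (I.to (proj₁ u)) ≡ true
        generated [ (y , p) , (z , q) ] = transport
          (∼-∙-cong (∼-∙-cong (∼-⁻¹-cong (from-to y)) (∼-⁻¹-cong (from-to z)))
                    (∼-∙-cong (from-to y) (from-to z)))
          -- The chosen representatives of `y` and `z` lie in S because N does, so `comm?` has
          -- tested their commutator.
          (Bool.¬-not λ Q≡ → ¬comm (_ , _ , S-resp (∼-sym (from-to y)) p , S-resp (∼-sym (from-to z)) q , Q≡))
        generated (resp p c) = transport (≈⇒∼ p) (generated c)
        generated unit = Bool.¬-not ¬unit
        generated (mul {y} {z} c c′) = transport (∼-∙-cong (from-to (proj₁ y)) (from-to (proj₁ z)))
          (Bool.¬-not λ Q≡ → ¬∙ (_ , _ , generated c , generated c′ , Q≡))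
        generated (inv {y} c) = transport (∼-⁻¹-cong (from-to (proj₁ y)))
          (Bool.¬-not λ Q≡ → ¬⁻¹ (_ , generated c , Q≡))

  derived-dec : Decidable C
  derived-dec z = map′ (C-resp (from-to z)) (C-resp (∼-sym (from-to z)))
    (least-closure-dec Grow.grow (I.to z))

-- Lifting from F/[R,R] to F along the tower L

module Lifting (F : ProfiniteGroup) {d : ℕ} (x : Fin d → ProfiniteGroup.Carrier F)
  (free : IsFreeProfinite F x) (H : FiniteGroup) (π : ContHom (ProfiniteGroup.top F) (discrete H))
  (π-surjective : Surjective (ProfiniteGroup._≈_ F) (FiniteGroup._≈_ H) (apply π)) where
  open ProfiniteGroup F
  open OpenSubgroups F
  open FreeProfinite F x free
  open Gaschütz F x free
  open RelationModule F H π π-surjective using (ker-π; R; conj; [R,R]-in-F; π̄-cong)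
  open GroupProperties group using (\\-leftDividesˡ)
  private
    module H = FiniteGroup H
    module R = TopGroup R

  R-open : OpenNormal
  R-open = record
    { normal = ker-π
    ; open? = ContHom.continuous π tt
    ; _∈? = λ z → Finite-dec H.setoid H.finite (apply π z) H.ε }

  private module R∼ = OpenNormal R-open

  -- The shift makes L 0 a subgroup of R.
  L : ℕ → OpenNormal
  L n = K (proj₁ (finite (proj₁ (ContHom.continuous π tt))) ℕ.+ n)

  module L n = OpenNormal (L n)

  L-invariant : ∀ n → Invariant (L n)
  L-invariant n = K-invariant _

  L-antitone : ∀ {m n} → m ≤ n → ∀ {z} → L.Mem n z → L.Mem m z
  L-antitone m≤n = K-antitone (ℕ.+-monoʳ-≤ _ m≤n)

  L-cofinal : ∀ i {z} → L.Mem (proj₁ (finite i)) z → ⟨ Nbhd i ⟩ z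
  L-cofinal i z∈L = K-cofinal i (K-antitone (ℕ.m≤n+m _ _) z∈L)

  L⊆R : ∀ n {z} → L.Mem n z → R∼.Mem z
  L⊆R n z∈L = proj₂ (ContHom.continuous π tt) (K-cofinal _ (K-antitone (ℕ.m≤m+n _ n) z∈L))

  L-separated : ∀ {y z} → (∀ n → L._∼_ n y z) → y ≈ z
  L-separated p = separated (λ i → L-cofinal i (p _))

  -- Completeness of F speaks of families over `Index`. Since `L (ν i)` lies in the basic subgroup
  -- of `i`, the term `s (ν i)` represents the limit there.
  L-complete : (s : ℕ → Carrier) → (∀ n → L._∼_ n (s (ℕ.suc n)) (s n)) →
               ∃ λ y → ∀ n → L._∼_ n y (s n)
  L-complete s coherent = y , λ n →
      let (i , i⊆) = L.open? n
      in L.∼-trans n (i⊆ (y∼ i)) (close n i i⊆)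
    where
    later : ∀ {m n} → m ℕ.≤′ n → L._∼_ m (s n) (s m)
    later {m} (ℕ.≤′-reflexive ≡.refl) = L.≈⇒∼ m refl
    later {m} (ℕ.≤′-step m≤n) = L.∼-trans m (L-antitone (ℕ.≤′⇒≤ m≤n) (coherent _)) (later m≤n)
    ν : Index → ℕ
    ν i = proj₁ (finite i)
    limit : ∃ λ y → ∀ i → y ≈[ i ] s (ν i)
    limit = complete (s ∘ ν) λ {i} {j} j⊆i → case i j j⊆i
      where
      case : ∀ i j → ⟨ Nbhd j ⟩ ⊆ ⟨ Nbhd i ⟩ → s (ν i) ≈[ i ] s (ν j)
      -- The two cases replace a proof that ν is monotone: if `ν j ≤ ν i`, the terms agree modulo
      -- the smaller subgroup `Nbhd j`.
      case i j j⊆i with ℕ.≤-total (ν i) (ν j)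
      ... | inj₁ i≤j = L-cofinal i (L.∼-sym (ν i) (later (ℕ.≤⇒≤′ i≤j)))
      ... | inj₂ j≤i = j⊆i (L-cofinal j (later (ℕ.≤⇒≤′ j≤i)))
    y = proj₁ limit
    y∼ = proj₂ limit
    close : ∀ n i → ⟨ Nbhd i ⟩ ⊆ L.Mem n → L._∼_ n (s (ν i)) (s n)
    close n i i⊆ with ℕ.≤-total n (ν i)
    ... | inj₁ n≤i = later (ℕ.≤⇒≤′ n≤i)
    ... | inj₂ i≤n = i⊆ (L-cofinal i (L.∼-sym (ν i) (later (ℕ.≤⇒≤′ i≤n))))

  -- The abstract commutator subgroup, dense in [R,R]. Corrections taken from it leave the induced
  -- map on F/[R,R] unchanged, and it can be decided modulo each `L n`.
  derivedR : NormalSubgroup group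
  derivedR = record
    { subgroup = record
      { Mem = λ z → Σ (R∼.Mem z) λ p → Commutators R.group (z , p)
      ; resp = λ p (q , c) → NormalSubgroup.resp ker-π p q , resp p c
      ; ε-closed = NormalSubgroup.ε-closed ker-π , unit
      ; ∙-closed = λ (p , c) (p′ , c′) → NormalSubgroup.∙-closed ker-π p p′ , mul c c′
      ; ⁻¹-closed = λ (p , c) → NormalSubgroup.⁻¹-closed ker-π p , inv c }
    ; conj-closed = λ g (p , c) → NormalSubgroup.conj-closed ker-π g p
        , Commutators-map R.group R.group (ContHom.hom (conj g)) c }

  C : ℕ → OpenNormal
  C n = record
    { normal = product group derivedR (OpenNormal.normal (L n))
    ; open? = let (i , i⊆) = L.open? n in
        i , λ z∈ → ε , NormalSubgroup.ε-closed derivedR , L.∼-sym n (L.Mem⇒∼ε n (i⊆ z∈))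
    ; _∈? = derived-dec group (OpenNormal.normal (L n)) (L.finite/ n)
              (NormalSubgroup.subgroup ker-π) R∼._∈? (L⊆R n) }

  module C n = OpenNormal (C n)
  module D = Quotient group [R,R]-in-F

  D⊆R : ∀ {z} → ⟨ [R,R]-in-F ⟩ z → R∼.Mem z
  D⊆R = proj₁

  D⊆C : ∀ n {z} → ⟨ [R,R]-in-F ⟩ z → C.Mem n z
  D⊆C n (z∈R , m) = let (i , i⊆) = L.open? n
                        (a , c , p) = m i in proj₁ a , (proj₂ a , c) , i⊆ p

  L⊆C : ∀ n {z} → L.Mem n z → C.Mem n z
  L⊆C n z∈L = ε , NormalSubgroup.ε-closed derivedR , L.∼-sym n (L.Mem⇒∼ε n z∈L)

  -- The closure is an intersection over all basic subgroups, and the `L n` are cofinal among them.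
  -- Thus a statement modulo [R,R] may be proved in the finite quotients F/C n.
  ⋂C⊆D : ∀ {z} → (∀ n → C.Mem n z) → ⟨ [R,R]-in-F ⟩ z
  ⋂C⊆D {z} m = z∈R , λ i → let (a , (p , c) , q) = m (proj₁ (finite i)) in (a , p) , c , L-cofinal i q
    where
    z∈R : R∼.Mem z
    z∈R = let (a , (p , c) , q) = m 0 in R∼.∼ε⇒Mem (R∼.∼-trans (L⊆R 0 (L.∼-sym 0 q)) (R∼.Mem⇒∼ε p))

  derivedR⊆D : ∀ {z} → ⟨ derivedR ⟩ z → ⟨ [R,R]-in-F ⟩ z
  derivedR⊆D m = ⋂C⊆D λ n → _ , m , L.≈⇒∼ n refl

  D-map : (f : ContHom top top) → (∀ z → apply f z R∼.∼ z) → ∀ {z} → ⟨ [R,R]-in-F ⟩ z → ⟨ [R,R]-in-F ⟩ (apply f z)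
  D-map f f∼id {z} (p , m) = f-R p , closedDerived-map R R (restrict top (NormalSubgroup.subgroup ker-π) f f-R) {z , p} m
    where
    f-R : ∀ {z} → R∼.Mem z → R∼.Mem (apply f z)
    f-R {z} m = H.trans (π̄-cong (f∼id z)) m

  -- An endomorphism of F/[R,R] over H (θ itself does not act on F).
  record EndoModD : Set where
    field
      θ      : Carrier → Carrier
      θ-cong : ∀ {y z} → y ≈ z → θ y D.∼ θ z
      θ-homo : ∀ y z → θ (y ∙ z) D.∼ θ y ∙ θ z
      θ-cont : ∀ n → ∃ λ i → ∀ {z} → ⟨ Nbhd i ⟩ z → C.Mem n (θ z)
      π∘θ    : ∀ z → θ z R∼.∼ z
      θ-surj : ∀ z → ∃ λ w → θ w D.∼ z

  module Lift (endoModD : EndoModD) where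
    open EndoModD endoModD

    module _ (α : ContHom top top) (α∼θ : ∀ k → apply α (x k) D.∼ θ (x k)) where
      lifts : ∀ z → apply α z D.∼ θ z
      lifts z = ⋂C⊆D λ n → unique-mod (C n) α θ (λ p → D⊆C n (θ-cong p))
        (λ y z → D⊆C n (θ-homo y z)) (θ-cont n) (λ k → D⊆C n (α∼θ k)) z

      lifts-R : ∀ z → apply α z R∼.∼ z
      lifts-R z = R∼.∼-trans (D⊆R (lifts z)) (π∘θ z)

    -- The preimages `w` of the generators make α onto F/L n, hence bijective there. They are kept
    -- as data because the inverse of the final automorphism is the limit of the maps `endo w`.
    record Stage (n : ℕ) : Set where
      field
        α   : ContHom top top
        α∼θ : ∀ k → apply α (x k) D.∼ θ (x k)
        w   : Fin d → Carrier
        α-w : ∀ k → L._∼_ n (apply α (w k)) (x k)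

    -- M is the modulus up to which the previous stage must survive, so that the stages converge.
    -- Gaschütz's lemma is applied to M ∩ C n, hence α must be onto modulo both at once.
    refine : ∀ n (M : OpenNormal) → (∀ {z} → L.Mem n z → OpenNormal.Mem M z) →
             (α : ContHom top top) → (∀ k → apply α (x k) D.∼ θ (x k)) →
             (∀ z → ∃ λ w → OpenNormal._∼_ M (apply α w) z × C._∼_ n (apply α w) z) →
             Σ (Stage n) λ s → ∀ k → OpenNormal._∼_ M (apply (Stage.α s) (x k)) (apply α (x k))
    refine n M L⊆M α α∼θ surj = record
        { α = endo y′
        ; α∼θ = λ k → D.∼-trans (D.≈⇒∼ (endo-x y′ k)) (D.∼-trans (y′∼αx k) (α∼θ k))
        ; w = λ k → proj₁ (y-gen k)
        ; α-w = λ k → L.∼-trans n (unique-endo-mod (L n) (endo y′) (endo y)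
            (λ j → L.∼-trans n (L.≈⇒∼ n (endo-x y′ j)) (L.∼-trans n (y′∼y j) (L.≈⇒∼ n (sym (endo-x y j))))) _)
            (proj₂ (y-gen k)) }
      , λ k → M.∼-trans (M.≈⇒∼ (endo-x y′ k)) (M.∼-trans (L⊆M (y′∼y k)) (proj₁ (y∼αx k)))
      where
      module M = OpenNormal M
      M∩C : OpenNormal
      M∩C = record
        { normal = record
          { subgroup = record
            { Mem = λ z → M.Mem z × C.Mem n z
            ; resp = λ p (m , c) → MN.resp p m , CN.resp p c
            ; ε-closed = MN.ε-closed , CN.ε-closed
            ; ∙-closed = λ (m , c) (m′ , c′) → MN.∙-closed m m′ , CN.∙-closed c c′
            ; ⁻¹-closed = λ (m , c) → MN.⁻¹-closed m , CN.⁻¹-closed c }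
          ; conj-closed = λ g (m , c) → MN.conj-closed g m , CN.conj-closed g c }
        ; open? = let (i , i⊆) = M.open?
                      (j , j⊆) = C.open? n
                      (k , k⊆i , k⊆j) = directed i j in k , λ z∈ → i⊆ (k⊆i z∈) , j⊆ (k⊆j z∈)
        ; _∈? = λ z → (z M.∈?) ×-dec (C._∈? n z) }
        where
        module MN = NormalSubgroup M.normal
        module CN = NormalSubgroup (C.normal n)
      g = gaschütz (L n) (L-invariant n) M∩C (λ z∈L → L⊆M z∈L , L⊆C n z∈L) α surj
      y = proj₁ g
      y∼αx = proj₁ (proj₂ g)
      y-gen = proj₂ (proj₂ g)
      -- The tuple `y` agrees with `α (x k)` only modulo [R,R]L n, which would spoil the induced map
      -- θ. Only the commutator factor `c k` of the difference is kept; the discarded factor lies in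
      -- L n, so `y′` still generates F/L n.
      correction : ∀ k → C.Mem n (apply α (x k) ⁻¹ ∙ y k)
      correction k = C.∼-sym n (proj₂ (y∼αx k))
      c : Fin d → Carrier
      c k = proj₁ (correction k)
      y′ : Fin d → Carrier
      y′ k = apply α (x k) ∙ c k
      y′∼y : ∀ k → L._∼_ n (y′ k) (y k)
      y′∼y k = L.∼-trans n (L.∼-∙-cong n (L.≈⇒∼ n refl) (proj₂ (proj₂ (correction k))))
        (L.≈⇒∼ n (\\-leftDividesˡ (apply α (x k)) (y k)))
      y′∼αx : ∀ k → y′ k D.∼ apply α (x k)
      y′∼αx k = D.∼-trans (D.∼-∙-cong (D.≈⇒∼ refl) (D.Mem⇒∼ε (derivedR⊆D (proj₁ (proj₂ (correction k))))))
        (D.≈⇒∼ (identityʳ _))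

    module StageProperties {n : ℕ} (s : Stage n) where
      open Stage s public

      α∘e : ∀ z → L._∼_ n (apply α (apply (endo w) z)) z
      α∘e = unique-endo-mod (L n) (α ∘ʰ endo w) idHom
        (λ k → L.∼-trans n (L.≈⇒∼ n (ContHom.⟦⟧-cong α (endo-x w k))) (α-w k))

      e-R : ∀ z → apply (endo w) z R∼.∼ z
      e-R z = R∼.∼-trans (R∼.∼-sym (lifts-R α α∼θ _)) (L⊆R n (α∘e z))

      -- α is onto modulo [R,R] because θ is; elements of [R,R] are hit modulo
      -- L n by elements of [R,R] because e preserves [R,R].
      α-surj : ∀ z → ∃ λ u → L._∼_ n (apply α u) z × apply α u D.∼ z
      α-surj z = u₀ ∙ apply (endo w) δ
        , L.∼-trans n (L.∼-trans n (L.≈⇒∼ n (ContHom.homo α _ _)) (L.∼-∙-cong n (L.≈⇒∼ n refl) (α∘e δ)))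
                      (L.≈⇒∼ n (\\-leftDividesˡ (apply α u₀) z))
        , D.∼-trans (D.≈⇒∼ (ContHom.homo α _ _)) (D.∼-trans
            (D.∼-∙-cong αu₀∼z (D.Mem⇒∼ε (D-map α (lifts-R α α∼θ) (D-map (endo w) e-R αu₀∼z))))
            (D.≈⇒∼ (identityʳ z)))
        where
        u₀ = proj₁ (θ-surj z)
        αu₀∼z : apply α u₀ D.∼ z
        αu₀∼z = D.∼-trans (lifts α α∼θ u₀) (proj₂ (θ-surj z))
        δ = apply α u₀ ⁻¹ ∙ z

      -- `endo w` is a right inverse of α on the finite group F/L n, so it is injective, therefore
      -- surjective, and α is its two-sided inverse.
      α-inj : ∀ {y z} → L._∼_ n (apply α y) (apply α z) → L._∼_ n y z
      α-inj {y} {z} p = L.∼-trans n (L.∼-sym n (proj₂ (e-onto y)))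
          (L.∼-trans n (invariant-cong (L n) (L-invariant n) (endo w) u∼v) (proj₂ (e-onto z)))
        where
        e-onto : ∀ t → ∃ λ u → L._∼_ n (apply (endo w) u) t
        e-onto = Finite-injective⇒surjective (L.setoid/ n) (L.finite/ n) (apply (endo w))
          (invariant-cong (L n) (L-invariant n) (endo w))
          (λ {u} {v} q → L.∼-trans n (L.∼-sym n (α∘e u)) (L.∼-trans n (invariant-cong (L n) (L-invariant n) α q) (α∘e v)))
        u = proj₁ (e-onto y)
        v = proj₁ (e-onto z)
        α-eu : ∀ {t} (r : ∃ λ u → L._∼_ n (apply (endo w) u) t) → L._∼_ n (proj₁ r) (apply α t)
        α-eu (u , r) = L.∼-trans n (L.∼-sym n (α∘e u)) (invariant-cong (L n) (L-invariant n) α r)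
        u∼v : L._∼_ n u v
        u∼v = L.∼-trans n (α-eu (e-onto y)) (L.∼-trans n p (L.∼-sym n (α-eu (e-onto z))))

    -- The first stage has no predecessor to stay close to, so it is refined modulo all of F.
    whole : OpenNormal
    whole = record
      { normal = record
        { subgroup = record { Mem = λ _ → ⊤ } }
      ; open? = inhabited , _
      ; _∈? = λ _ → yes tt }

    first : Stage 0
    first = proj₁ (refine 0 whole _ (endo (θ ∘ x)) endo∼θ λ z →
        let (w , p) = θ-surj z in w , tt , D⊆C 0 (D.∼-trans (lifts (endo (θ ∘ x)) endo∼θ w) p))
      where
      endo∼θ : ∀ k → apply (endo (θ ∘ x)) (x k) D.∼ θ (x k)
      endo∼θ k = D.≈⇒∼ (endo-x (θ ∘ x) k)

    next : ∀ {n} (s : Stage n) → Σ (Stage (ℕ.suc n)) λ s′ →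
           ∀ k → L._∼_ n (apply (Stage.α s′) (x k)) (apply (Stage.α s) (x k))
    next {n} s = refine (ℕ.suc n) (L n) (L-antitone (ℕ.n≤1+n n)) α α∼θ λ z →
        let (u , p , q) = α-surj z in u , p , D⊆C (ℕ.suc n) q
      where open StageProperties s

    stage : ∀ n → Stage n
    stage ℕ.zero    = first
    stage (ℕ.suc n) = proj₁ (next (stage n))

    module S n = StageProperties (stage n)

    lift : ∃ λ (α : TopAut top) → ∀ z → apply (TopAut.to α) z D.∼ θ z
    lift = record { to = α ; from = β ; invˡ = λ z → L-separated (λ n → α∘β n z) ; invʳ = invʳ }
        , λ z → ⋂C⊆D λ n → C.∼-trans n (L⊆C n (α∼ n z)) (D⊆C n (lifts (S.α n) (S.α∼θ n) z))
      where
      limit : ∀ k → ∃ λ y → ∀ n → L._∼_ n y (apply (S.α n) (x k))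
      limit k = L-complete (λ n → apply (S.α n) (x k)) (λ n → proj₂ (next (stage n)) k)
      α : ContHom top top
      α = endo (λ k → proj₁ (limit k))
      α∼ : ∀ n z → L._∼_ n (apply α z) (apply (S.α n) z)
      α∼ n = unique-endo-mod (L n) α (S.α n)
        (λ k → L.∼-trans n (L.≈⇒∼ n (endo-x _ k)) (proj₂ (limit k) n))
      α-inj : ∀ n {y z} → L._∼_ n (apply α y) (apply α z) → L._∼_ n y z
      α-inj n p = S.α-inj n (L.∼-trans n (L.∼-sym n (α∼ n _)) (L.∼-trans n p (α∼ n _)))
      α-w : ∀ n k → L._∼_ n (apply α (S.w n k)) (x k)
      α-w n k = L.∼-trans n (α∼ n _) (S.α-w n k)
      -- Modulo L n the limit α sends both `w` of stage n and `w` of stage n + 1 to the generators;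
      -- by injectivity they agree there and form a convergent sequence.
      limit⁻¹ : ∀ k → ∃ λ y → ∀ n → L._∼_ n y (S.w n k)
      limit⁻¹ k = L-complete (λ n → S.w n k) λ n → α-inj n
        (L.∼-trans n (L-antitone (ℕ.n≤1+n n) (α-w (ℕ.suc n) k)) (L.∼-sym n (α-w n k)))
      β : ContHom top top
      β = endo (λ k → proj₁ (limit⁻¹ k))
      α∘β : ∀ n z → L._∼_ n (apply α (apply β z)) z
      α∘β n = unique-endo-mod (L n) (α ∘ʰ β) idHom λ k → L.∼-trans n
        (invariant-cong (L n) (L-invariant n) α
          (L.∼-trans n (L.≈⇒∼ n (endo-x _ k)) (proj₂ (limit⁻¹ k) n))) (α-w n k)
      invʳ : ∀ z → apply β (apply α z) ≈ z
      invʳ z = L-separated λ n → α-inj n (α∘β n (apply α z))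

-- Endomorphisms of an extension over H and trivialisations of the difference of classes

-- The equation β − φ_*(β) = δb.
record Trivialisation {H : Grp} (M : HModule H) (φ : HModule.Carrier M → HModule.Carrier M)
  (c : Group.Carrier H → Group.Carrier H → HModule.Carrier M) : Set where
  private module H = Group H
  open HModule M
  field
    b          : H.Carrier → Carrier
    b-cong     : ∀ {g h} → g H.≈ h → b g ≈ b h
    b-relation : ∀ g h → φ (c g h) ⁻¹ ∙ c g h ≈ (g · b h ∙ b g) ∙ b (g H.∙ h) ⁻¹

-- M, s and β stand for hModule, s and extensionClass of an extension.
module ExtensionEndomorphisms (H : FiniteGroup) (M : HModule (FiniteGroup.group H)) (E : Grp)
  (ι : Hom (HModule.group M) E) (p : Hom E (FiniteGroup.group H))
  (ι-injective′ : ∀ a b → Group._≈_ E (⟦ ι ⟧ a) (⟦ ι ⟧ b) → HModule._≈_ M a b)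
  (im⊆ker : ∀ a → FiniteGroup._≈_ H (⟦ p ⟧ (⟦ ι ⟧ a)) (FiniteGroup.ε H))
  (ker⊆im : ∀ {z} → FiniteGroup._≈_ H (⟦ p ⟧ z) (FiniteGroup.ε H) → ∃ λ a → Group._≈_ E (⟦ ι ⟧ a) z)
  (s : FiniteGroup.Carrier H → Group.Carrier E)
  (s-cong : ∀ {g h} → FiniteGroup._≈_ H g h → Group._≈_ E (s g) (s h))
  (p∘s : ∀ h → FiniteGroup._≈_ H (⟦ p ⟧ (s h)) h)
  (ι-act : ∀ h a → Group._≈_ E (⟦ ι ⟧ (HModule._·_ M h a)) (⟦ conjugation E (s h) ⟧ (⟦ ι ⟧ a)))
  (β : Cocycle₂ M)
  (ι-β : ∀ g h → Group._≈_ E (⟦ ι ⟧ (Cocycle₂.fun β g h))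
           (Group._∙_ E (Group._∙_ E (s g) (s h)) (Group._⁻¹ E (s (FiniteGroup._∙_ H g h)))))
  where
  private
    module H = FiniteGroup H
    module M = HModule M
    module ι = GroupHomomorphism ι
    module p = GroupHomomorphism p
    open Group E
    open GroupProperties E
    open SetoidReasoning setoid

    ι-injective : ∀ {a b} → ⟦ ι ⟧ a ≈ ⟦ ι ⟧ b → a M.≈ b
    ι-injective = ι-injective′ _ _

    c : H.Carrier → H.Carrier → M.Carrier
    c = Cocycle₂.fun β

    conj : Carrier → Carrier → Carrier
    conj e z = e ∙ z ∙ e ⁻¹

    conj-cong : ∀ {e f y z} → e ≈ f → y ≈ z → conj e y ≈ conj f z
    conj-cong e≈f y≈z = ∙-cong (∙-cong e≈f y≈z) (⁻¹-cong e≈f)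

    commute : ∀ {z} a → ⟦ p ⟧ z H.≈ H.ε → z ∙ ⟦ ι ⟧ a ≈ ⟦ ι ⟧ a ∙ z
    commute {z} a pz≈ε with u , ιu≈z ← ker⊆im pz≈ε = begin
      z ∙ ⟦ ι ⟧ a       ≈⟨ ∙-congʳ ιu≈z ⟨
      ⟦ ι ⟧ u ∙ ⟦ ι ⟧ a ≈⟨ ι.homo u a ⟨
      ⟦ ι ⟧ (u M.∙ a)   ≈⟨ ι.⟦⟧-cong (M.comm u a) ⟩
      ⟦ ι ⟧ (a M.∙ u)   ≈⟨ ι.homo a u ⟩
      ⟦ ι ⟧ a ∙ ⟦ ι ⟧ u ≈⟨ ∙-congˡ ιu≈z ⟩
      ⟦ ι ⟧ a ∙ z       ∎

    conj-fibre : ∀ {e f} a → ⟦ p ⟧ e H.≈ ⟦ p ⟧ f → conj e (⟦ ι ⟧ a) ≈ conj f (⟦ ι ⟧ a)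
    conj-fibre {e} {f} a pe≈pf = begin
      e ∙ ⟦ ι ⟧ a ∙ e ⁻¹                    ≈⟨ ∙-congʳ (∙-congʳ (\\-leftDividesˡ f e)) ⟨
      f ∙ (f ⁻¹ ∙ e) ∙ ⟦ ι ⟧ a ∙ e ⁻¹       ≈⟨ ∙-congʳ (assoc _ _ _) ⟩
      f ∙ (f ⁻¹ ∙ e ∙ ⟦ ι ⟧ a) ∙ e ⁻¹       ≈⟨ ∙-congʳ (∙-congˡ (commute a (H.trans (p.homo _ _)
                                                 (H.trans (H.∙-cong (p.⁻¹-homo f) pe≈pf) (H.inverseˡ _))))) ⟩
      f ∙ (⟦ ι ⟧ a ∙ (f ⁻¹ ∙ e)) ∙ e ⁻¹     ≈⟨ ∙-congʳ (trans (sym (assoc _ _ _)) (sym (assoc _ _ _))) ⟩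
      f ∙ ⟦ ι ⟧ a ∙ f ⁻¹ ∙ e ∙ e ⁻¹         ≈⟨ //-rightDividesʳ e _ ⟩
      f ∙ ⟦ ι ⟧ a ∙ f ⁻¹                    ∎

    s∙ι : ∀ g a → s g ∙ ⟦ ι ⟧ a ≈ ⟦ ι ⟧ (g M.· a) ∙ s g
    s∙ι g a = sym (trans (∙-congʳ (ι-act g a)) (//-rightDividesˡ (s g) _))

    s∙s : ∀ g h → s g ∙ s h ≈ ⟦ ι ⟧ (c g h) ∙ s (g H.∙ h)
    s∙s g h = sym (trans (∙-congʳ (ι-β g h)) (//-rightDividesˡ (s (g H.∙ h)) _))

  module _ (θ : Hom E E) (p∘θ : ∀ z → ⟦ p ⟧ (⟦ θ ⟧ z) H.≈ ⟦ p ⟧ z) where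
    private module θ = GroupHomomorphism θ

    -- Conjugation on the image of ι depends only on the fibre of p, and θ (s h) lies in the fibre
    -- of s h.
    restriction-equivariant : (φ : Hom M.group M.group) → (∀ a → ⟦ ι ⟧ (⟦ φ ⟧ a) ≈ ⟦ θ ⟧ (⟦ ι ⟧ a)) →
                              ∀ h a → ⟦ φ ⟧ (h M.· a) M.≈ h M.· ⟦ φ ⟧ a
    restriction-equivariant φ ι∘φ h a = ι-injective (begin
      ⟦ ι ⟧ (⟦ φ ⟧ (h M.· a))              ≈⟨ ι∘φ _ ⟩
      ⟦ θ ⟧ (⟦ ι ⟧ (h M.· a))              ≈⟨ θ.⟦⟧-cong (ι-act h a) ⟩
      ⟦ θ ⟧ (s h ∙ ⟦ ι ⟧ a ∙ s h ⁻¹)        ≈⟨ trans (θ.homo _ _) (∙-cong (θ.homo _ _) (θ.⁻¹-homo _)) ⟩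
      conj (⟦ θ ⟧ (s h)) (⟦ θ ⟧ (⟦ ι ⟧ a)) ≈⟨ conj-cong refl (ι∘φ a) ⟨
      conj (⟦ θ ⟧ (s h)) (⟦ ι ⟧ (⟦ φ ⟧ a)) ≈⟨ conj-fibre (⟦ φ ⟧ a) (p∘θ (s h)) ⟩
      conj (s h) (⟦ ι ⟧ (⟦ φ ⟧ a))         ≈⟨ ι-act h _ ⟨
      ⟦ ι ⟧ (h M.· ⟦ φ ⟧ a)                ∎)

    private
      defect-∈ker : ∀ g → ⟦ p ⟧ (s g ∙ ⟦ θ ⟧ (s g) ⁻¹) H.≈ H.ε
      defect-∈ker g = H.trans (p.homo _ _) (H.trans
        (H.∙-congˡ (H.trans (p.⁻¹-homo _) (H.⁻¹-cong (p∘θ (s g))))) (H.inverseʳ _))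

      -- `θ ∘ s` is a second section of p, with cocycle φ ∘ c. The cochain `b` compares it with `s`.
      b : H.Carrier → M.Carrier
      b g = proj₁ (ker⊆im (defect-∈ker g))

      ι-b : ∀ g → ⟦ ι ⟧ (b g) ≈ s g ∙ ⟦ θ ⟧ (s g) ⁻¹
      ι-b g = proj₂ (ker⊆im (defect-∈ker g))

      b∙θs : ∀ g → ⟦ ι ⟧ (b g) ∙ ⟦ θ ⟧ (s g) ≈ s g
      b∙θs g = trans (∙-congʳ (ι-b g)) (//-rightDividesˡ (⟦ θ ⟧ (s g)) (s g))

      -- Expand `s g ∙ s h` once through c and once by writing each factor as `ι b ∙ θ s`, then
      -- cancel θ (s (gh)).
      b-relation : (φ : Hom M.group M.group) → (∀ a → ⟦ ι ⟧ (⟦ φ ⟧ a) ≈ ⟦ θ ⟧ (⟦ ι ⟧ a)) →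
        ∀ g h → c g h M.∙ b (g H.∙ h) M.≈ (g M.· b h M.∙ b g) M.∙ ⟦ φ ⟧ (c g h)
      b-relation φ ι∘φ g h = ι-injective (∙-cancelʳ (⟦ θ ⟧ (s (g H.∙ h))) _ _ (begin
        ⟦ ι ⟧ (c g h M.∙ b (g H.∙ h)) ∙ ⟦ θ ⟧ (s (g H.∙ h))         ≈⟨ ∙-congʳ (ι.homo _ _) ⟩
        ⟦ ι ⟧ (c g h) ∙ ⟦ ι ⟧ (b (g H.∙ h)) ∙ ⟦ θ ⟧ (s (g H.∙ h))  ≈⟨ assoc _ _ _ ⟩
        ⟦ ι ⟧ (c g h) ∙ (⟦ ι ⟧ (b (g H.∙ h)) ∙ ⟦ θ ⟧ (s (g H.∙ h))) ≈⟨ ∙-congˡ (b∙θs _) ⟩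
        ⟦ ι ⟧ (c g h) ∙ s (g H.∙ h)                                 ≈⟨ s∙s g h ⟨
        s g ∙ s h                                                   ≈⟨ ∙-congˡ (b∙θs h) ⟨
        s g ∙ (⟦ ι ⟧ (b h) ∙ ⟦ θ ⟧ (s h))                          ≈⟨ assoc _ _ _ ⟨
        s g ∙ ⟦ ι ⟧ (b h) ∙ ⟦ θ ⟧ (s h)                            ≈⟨ ∙-congʳ (s∙ι g (b h)) ⟩
        ⟦ ι ⟧ (g M.· b h) ∙ s g ∙ ⟦ θ ⟧ (s h)                      ≈⟨ ∙-congʳ (∙-congˡ (b∙θs g)) ⟨
        ⟦ ι ⟧ (g M.· b h) ∙ (⟦ ι ⟧ (b g) ∙ ⟦ θ ⟧ (s g)) ∙ ⟦ θ ⟧ (s h) ≈⟨ ∙-congʳ (assoc _ _ _) ⟨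
        ⟦ ι ⟧ (g M.· b h) ∙ ⟦ ι ⟧ (b g) ∙ ⟦ θ ⟧ (s g) ∙ ⟦ θ ⟧ (s h) ≈⟨ assoc _ _ _ ⟩
        ⟦ ι ⟧ (g M.· b h) ∙ ⟦ ι ⟧ (b g) ∙ (⟦ θ ⟧ (s g) ∙ ⟦ θ ⟧ (s h)) ≈⟨ ∙-cong (ι.homo _ _) (θ.homo _ _) ⟨
        ⟦ ι ⟧ (g M.· b h M.∙ b g) ∙ ⟦ θ ⟧ (s g ∙ s h)               ≈⟨ ∙-congˡ (trans (θ.⟦⟧-cong (s∙s g h)) (θ.homo _ _)) ⟩
        ⟦ ι ⟧ (g M.· b h M.∙ b g) ∙ (⟦ θ ⟧ (⟦ ι ⟧ (c g h)) ∙ ⟦ θ ⟧ (s (g H.∙ h))) ≈⟨ assoc _ _ _ ⟨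
        ⟦ ι ⟧ (g M.· b h M.∙ b g) ∙ ⟦ θ ⟧ (⟦ ι ⟧ (c g h)) ∙ ⟦ θ ⟧ (s (g H.∙ h)) ≈⟨ ∙-congʳ (∙-congˡ (ι∘φ _)) ⟨
        ⟦ ι ⟧ (g M.· b h M.∙ b g) ∙ ⟦ ι ⟧ (⟦ φ ⟧ (c g h)) ∙ ⟦ θ ⟧ (s (g H.∙ h)) ≈⟨ ∙-congʳ (ι.homo _ _) ⟨
        ⟦ ι ⟧ ((g M.· b h M.∙ b g) M.∙ ⟦ φ ⟧ (c g h)) ∙ ⟦ θ ⟧ (s (g H.∙ h)) ∎))

      transpose : ∀ {x y z t} → x M.∙ y M.≈ z M.∙ t → t M.⁻¹ M.∙ x M.≈ z M.∙ y M.⁻¹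
      transpose {x} {y} {z} {t} eq = AP.∙-cancelʳ y _ _ (M.trans (M.assoc _ _ _) (M.trans (M.∙-congˡ eq)
        (M.trans (M.∙-congˡ (M.comm z t)) (M.trans (AP.\\-leftDividesʳ t z)
        (M.sym (AP.//-rightDividesˡ y z))))))
        where module AP = GroupProperties M.group

    restriction-trivialisation : (φ : Hom M.group M.group) →
      (∀ a → ⟦ ι ⟧ (⟦ φ ⟧ a) ≈ ⟦ θ ⟧ (⟦ ι ⟧ a)) → Trivialisation M ⟦ φ ⟧ c
    restriction-trivialisation φ ι∘φ = record
      { b = b
      ; b-cong = λ {g} {h} g≈h → ι-injective (trans (ι-b g) (trans
          (∙-cong (s-cong g≈h) (⁻¹-cong (θ.⟦⟧-cong (s-cong g≈h)))) (sym (ι-b h))))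
      ; b-relation = λ g h → transpose (b-relation φ ι∘φ g h) }

  module _ (φ : HModuleHom M M) (t : Trivialisation M ⟦ HModuleHom.hom φ ⟧ (Cocycle₂.fun β)) where
    private
      module φ = GroupHomomorphism (HModuleHom.hom φ)
      open Trivialisation t

      κ-∈ker : ∀ z → ⟦ p ⟧ (z ∙ s (⟦ p ⟧ z) ⁻¹) H.≈ H.ε
      κ-∈ker z = H.trans (p.homo _ _) (H.trans
        (H.∙-congˡ (H.trans (p.⁻¹-homo _) (H.⁻¹-cong (p∘s _)))) (H.inverseʳ _))

      κ : Carrier → M.Carrier
      κ z = proj₁ (ker⊆im (κ-∈ker z))

      ι-κ : ∀ z → ⟦ ι ⟧ (κ z) ≈ z ∙ s (⟦ p ⟧ z) ⁻¹
      ι-κ z = proj₂ (ker⊆im (κ-∈ker z))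

      decompose : ∀ z → z ≈ ⟦ ι ⟧ (κ z) ∙ s (⟦ p ⟧ z)
      decompose z = sym (trans (∙-congʳ (ι-κ z)) (//-rightDividesˡ (s (⟦ p ⟧ z)) z))

      -- The value required at `ι a ∙ s h` of a homomorphism that is φ on M and sends `s h` to
      -- `ι (b h)⁻¹ ∙ s h`, the convention for `b` used in the other direction.
      twisted : M.Carrier → H.Carrier → Carrier
      twisted a h = ⟦ ι ⟧ (φ.⟦_⟧ a M.∙ b h M.⁻¹) ∙ s h

    extended : Carrier → Carrier
    extended z = twisted (κ z) (⟦ p ⟧ z)

    private
      p-ι∙s : ∀ a h → ⟦ p ⟧ (⟦ ι ⟧ a ∙ s h) H.≈ h
      p-ι∙s a h = H.trans (p.homo _ _) (H.trans (H.∙-cong (im⊆ker a) (p∘s h)) (H.identityˡ h))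

    extended-ι∙s : ∀ {z} a h → z ≈ ⟦ ι ⟧ a ∙ s h → extended z ≈ twisted a h
    extended-ι∙s {z} a h eq = ∙-cong (ι.⟦⟧-cong (M.∙-cong (φ.⟦⟧-cong κz≈a) (M.⁻¹-cong (b-cong pz≈h)))) (s-cong pz≈h)
      where
      pz≈h : ⟦ p ⟧ z H.≈ h
      pz≈h = H.trans (p.⟦⟧-cong eq) (p-ι∙s a h)
      κz≈a : κ z M.≈ a
      κz≈a = ι-injective (trans (ι-κ z) (trans (∙-cong eq (⁻¹-cong (s-cong pz≈h))) (//-rightDividesʳ (s h) _)))

    extended-cong : ∀ {y z} → y ≈ z → extended y ≈ extended z
    extended-cong {y} {z} y≈z = sym (extended-ι∙s (κ y) (⟦ p ⟧ y) (trans (sym y≈z) (decompose y)))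

    private
      ι∙s-∙ : ∀ a g a′ h → ⟦ ι ⟧ a ∙ s g ∙ (⟦ ι ⟧ a′ ∙ s h) ≈
              ⟦ ι ⟧ (a M.∙ g M.· a′ M.∙ c g h) ∙ s (g H.∙ h)
      ι∙s-∙ a g a′ h = begin
        ⟦ ι ⟧ a ∙ s g ∙ (⟦ ι ⟧ a′ ∙ s h)                           ≈⟨ assoc _ _ _ ⟩
        ⟦ ι ⟧ a ∙ (s g ∙ (⟦ ι ⟧ a′ ∙ s h))                         ≈⟨ ∙-congˡ (assoc _ _ _) ⟨
        ⟦ ι ⟧ a ∙ (s g ∙ ⟦ ι ⟧ a′ ∙ s h)                           ≈⟨ ∙-congˡ (∙-congʳ (s∙ι g a′)) ⟩
        ⟦ ι ⟧ a ∙ (⟦ ι ⟧ (g M.· a′) ∙ s g ∙ s h)                   ≈⟨ ∙-congˡ (assoc _ _ _) ⟩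
        ⟦ ι ⟧ a ∙ (⟦ ι ⟧ (g M.· a′) ∙ (s g ∙ s h))                 ≈⟨ assoc _ _ _ ⟨
        ⟦ ι ⟧ a ∙ ⟦ ι ⟧ (g M.· a′) ∙ (s g ∙ s h)                   ≈⟨ ∙-congˡ (s∙s g h) ⟩
        ⟦ ι ⟧ a ∙ ⟦ ι ⟧ (g M.· a′) ∙ (⟦ ι ⟧ (c g h) ∙ s (g H.∙ h)) ≈⟨ assoc _ _ _ ⟨
        ⟦ ι ⟧ a ∙ ⟦ ι ⟧ (g M.· a′) ∙ ⟦ ι ⟧ (c g h) ∙ s (g H.∙ h)   ≈⟨ ∙-congʳ (trans (ι.homo _ _) (∙-congʳ (ι.homo _ _))) ⟨
        ⟦ ι ⟧ (a M.∙ g M.· a′ M.∙ c g h) ∙ s (g H.∙ h)             ∎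

      -- Multiplicativity of the extension is the coboundary equation: `c g h` becomes `φ (c g h)`
      -- times δb, and all terms in `b g` and `b h` cancel.
      twist-∙ : ∀ a g a′ h → φ.⟦_⟧ (a M.∙ g M.· a′ M.∙ c g h) M.∙ b (g H.∙ h) M.⁻¹ M.≈
        (φ.⟦_⟧ a M.∙ b g M.⁻¹) M.∙ g M.· (φ.⟦_⟧ a′ M.∙ b h M.⁻¹) M.∙ c g h
      twist-∙ a g a′ h = M.trans (M.∙-congʳ φ-∙) (M.trans cancel (M.sym (M.∙-cong (M.∙-congˡ
          (M.trans (M.·-distrib g _ _) (M.∙-congˡ (M.·-⁻¹ g (b h))))) c-twisted)))
        where
        open CommutativeMonoidSolver M.commutativeMonoid
        φc = φ.⟦_⟧ (c g h)
        X = g M.· b h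
        Y = b g
        B⁻¹ = b (g H.∙ h) M.⁻¹
        φ-∙ : φ.⟦_⟧ (a M.∙ g M.· a′ M.∙ c g h) M.≈ φ.⟦_⟧ a M.∙ g M.· φ.⟦_⟧ a′ M.∙ φc
        φ-∙ = M.trans (φ.homo _ _) (M.∙-congʳ (M.trans (φ.homo _ _)
          (M.∙-congˡ (HModuleHom.equivariant φ g a′))))
        c-twisted : c g h M.≈ φc M.∙ (X M.∙ Y M.∙ B⁻¹)
        c-twisted = M.trans (M.sym (GroupProperties.\\-leftDividesˡ M.group φc (c g h))) (M.∙-congˡ (b-relation g h))
        cancel : φ.⟦_⟧ a M.∙ g M.· φ.⟦_⟧ a′ M.∙ φc M.∙ B⁻¹ M.≈
          (φ.⟦_⟧ a M.∙ Y M.⁻¹) M.∙ (g M.· φ.⟦_⟧ a′ M.∙ X M.⁻¹) M.∙ (φc M.∙ (X M.∙ Y M.∙ B⁻¹))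
        -- The solver knows commutative monoids only, so inverses enter as separate atoms and the
        -- products X⁻¹X and Y⁻¹Y are inserted by hand.
        cancel = M.trans (M.sym (M.trans (M.∙-congˡ (M.trans
            (M.∙-cong (M.inverseˡ X) (M.inverseˡ Y)) (M.identityˡ M.ε))) (M.identityʳ _)))
          (solve 8 (λ p q r s x⁻ x y⁻ y → ((((p ⊕ q) ⊕ r) ⊕ s) ⊕ ((x⁻ ⊕ x) ⊕ (y⁻ ⊕ y))) ⊜
            (((p ⊕ y⁻) ⊕ (q ⊕ x⁻)) ⊕ (r ⊕ ((x ⊕ y) ⊕ s)))) M.refl
            (φ.⟦_⟧ a) (g M.· φ.⟦_⟧ a′) φc B⁻¹ (X M.⁻¹) X (Y M.⁻¹) Y)

    extended-homo : ∀ y z → extended (y ∙ z) ≈ extended y ∙ extended z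
    extended-homo y z = begin
      extended (y ∙ z)                                  ≈⟨ extended-ι∙s _ _ (trans (∙-cong (decompose y) (decompose z)) (ι∙s-∙ _ _ _ _)) ⟩
      twisted (κ y M.∙ g M.· κ z M.∙ c g h) (g H.∙ h)   ≈⟨ ∙-congʳ (ι.⟦⟧-cong (twist-∙ (κ y) g (κ z) h)) ⟩
      ⟦ ι ⟧ ((φ.⟦_⟧ (κ y) M.∙ b g M.⁻¹) M.∙ g M.· (φ.⟦_⟧ (κ z) M.∙ b h M.⁻¹) M.∙ c g h) ∙ s (g H.∙ h) ≈⟨ ι∙s-∙ _ _ _ _ ⟨
      extended y ∙ extended z                           ∎
      where
      g = ⟦ p ⟧ y
      h = ⟦ p ⟧ z

    p∘extended : ∀ z → ⟦ p ⟧ (extended z) H.≈ ⟦ p ⟧ z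
    p∘extended z = p-ι∙s _ _

    -- The section is not normalised, so `s ε` may differ from `ε`. Multiplying by `e = ε` in its
    -- normal form and cancelling `extended e` avoids computing `b` at the identity.
    extended∘ι : ∀ a → extended (⟦ ι ⟧ a) ≈ ⟦ ι ⟧ (φ.⟦_⟧ a)
    extended∘ι a = ∙-cancelʳ (extended e) _ _ (begin
      extended (⟦ ι ⟧ a) ∙ extended e ≈⟨ extended-homo _ _ ⟨
      extended (⟦ ι ⟧ a ∙ e) ≈⟨ extended-ι∙s (a M.∙ κ e) h (trans (∙-congˡ (decompose e))
                                  (trans (sym (assoc _ _ _)) (∙-congʳ (sym (ι.homo _ _))))) ⟩
      twisted (a M.∙ κ e) h ≈⟨ ∙-congʳ (trans (ι.⟦⟧-cong (M.trans (M.∙-congʳ (φ.homo a (κ e))) (M.assoc _ _ _))) (ι.homo _ _)) ⟩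
      ⟦ ι ⟧ (φ.⟦_⟧ a) ∙ ⟦ ι ⟧ (φ.⟦_⟧ (κ e) M.∙ b h M.⁻¹) ∙ s h ≈⟨ assoc _ _ _ ⟩
      ⟦ ι ⟧ (φ.⟦_⟧ a) ∙ extended e ∎)
      where
      e = ε
      h = ⟦ p ⟧ e

    extended-surjective : (∀ a → ∃ λ a′ → φ.⟦_⟧ a′ M.≈ a) → ∀ z → ∃ λ w → extended w ≈ z
    extended-surjective φ-surjective z =
      let h = ⟦ p ⟧ z
          (a′ , eq) = φ-surjective (κ z M.∙ b h)
      in ⟦ ι ⟧ a′ ∙ s h , trans (extended-ι∙s a′ h refl) (trans
           (∙-congʳ (ι.⟦⟧-cong (M.trans (M.∙-congʳ eq) (GroupProperties.//-rightDividesʳ M.group (b h) (κ z)))))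
           (sym (decompose z)))

-- Continuous homomorphisms and Ẑ-powers

module ẐPowers (F : ProfiniteGroup) where
  open ProfiniteGroup F
  open ẐPower F
  open Power group

  private
    module U i = Quotient group (Nbhd i)

  residue : Ẑ → Index → ℕ
  residue z i = Ẑ.residue z (ord i) {{ord≢0 i}}

  ^̂∼^ : ∀ y z i → y ^̂ z ≈[ i ] y ^ residue z i
  ^̂∼^ y z = proj₂ (complete (approx y z) (approx-coherent y z))

  ^-map : (f : ContHom top top) → ∀ y n → apply f (y ^ n) ≈ apply f y ^ n
  ^-map f y ℕ.zero    = ContHom.ε-homo f
  ^-map f y (ℕ.suc n) = trans (ContHom.homo f _ _) (∙-congˡ (^-map f y n))

  -- To be applied to u = y ^̂ z and v = f(y) ^̂ z.
  limit-map : (f : ContHom top top) {y u v : Carrier} (n : Index → ℕ) →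
    (∀ i → u ≈[ i ] y ^ n i) → (∀ i → v ≈[ i ] apply f y ^ n i) → apply f u ≈ v
  limit-map f {y} {u} n u∼ v∼ = separated λ i →
    let (j , f-cont) = ContHom.continuous f i
        -- Both approximations must use the same exponent, so `k` refines `i` and also the `j` given
        -- by continuity.
        (k , k⊆i , k⊆j) = directed i j
        f-∼ : apply f u ≈[ i ] apply f (y ^ n k)
        f-∼ = NormalSubgroup.resp (Nbhd i) (trans (ContHom.homo f _ _) (∙-congʳ (ContHom.⁻¹-homo f _)))
                (f-cont (k⊆j (u∼ k)))
    in U.∼-trans i f-∼ (U.∼-trans i (U.≈⇒∼ i (^-map f y (n k))) (U.∼-sym i (k⊆i (v∼ k))))

-- The two inclusions

module Theorem (F : ProfiniteGroup) {d : ℕ} (x : Fin d → ProfiniteGroup.Carrier F)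
  (free : IsFreeProfinite F x) (H : FiniteGroup) (π : ContHom (ProfiniteGroup.top F) (discrete H))
  (π-surjective : Surjective (ProfiniteGroup._≈_ F) (FiniteGroup._≈_ H) (apply π)) where
  open RelationModule F H π π-surjective
  open Lifting F x free H π π-surjective
  private
    injective : ∀ a b → Group._≈_ (RelationModule.F/[R,R] F H π π-surjective) (proj₁ a) (proj₁ b) →
                HModule._≈_ (RelationModule.R̄-module F H π π-surjective) a b
    injective a b = Extension.ι-injective (RelationModule.extension F H π π-surjective) {a} {b}

  open ExtensionEndomorphisms H
    (RelationModule.R̄-module F H π π-surjective)
    (RelationModule.F/[R,R] F H π π-surjective)
    (Extension.ι (RelationModule.extension F H π π-surjective))
    (Extension.p (RelationModule.extension F H π π-surjective))
    injective
    (Extension.im⊆ker (RelationModule.extension F H π π-surjective))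
    (Extension.ker⊆im (RelationModule.extension F H π π-surjective))
    (ExtensionClass.s (RelationModule.extension F H π π-surjective))
    (ExtensionClass.s-cong (RelationModule.extension F H π π-surjective))
    (ExtensionClass.p∘s (RelationModule.extension F H π π-surjective))
    (ExtensionClass.ι-act (RelationModule.extension F H π π-surjective))
    (RelationModule.β F H π π-surjective)
    (ExtensionClass.ι-c (RelationModule.extension F H π π-surjective))
  open ẐPowers F
  private
    module F = ProfiniteGroup F
    module H = FiniteGroup H
    module R = TopGroup R
    module R̄ = TopGroup R̄
    module ι = GroupHomomorphism (Extension.ι extension)
    module R∼ = OpenSubgroups.OpenNormal R-open

    π≈⇒∼ : ∀ {y z} → apply π y H.≈ apply π z → y R∼.∼ z
    π≈⇒∼ p = H.trans (ContHom.homo π _ _) (H.trans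
      (H.∙-cong (ContHom.⁻¹-homo π _) (H.sym p)) (H.inverseˡ _))

    abstract
      R̄≈⇒∼ : ∀ a b → a R̄.≈ b → proj₁ a D.∼ proj₁ b
      R̄≈⇒∼ a b = ι.⟦⟧-cong {a} {b}

      ∼⇒R̄≈ : ∀ a b → proj₁ a D.∼ proj₁ b → a R̄.≈ b
      ∼⇒R̄≈ a b = Extension.ι-injective extension {a} {b}

    infixr 8 _^_
    _^_ : F.Carrier → ℕ → F.Carrier
    _^_ = Power._^_ F.group

    abstract
      ·̂-approx : ∀ z (a : R.Carrier) i → proj₁ (z ·̂ a) F.≈[ i ] proj₁ a ^ residue z i
      ·̂-approx z (y , p) i = ^̂∼^ y z i

  -- Congruent elements have congruent ordinary powers modulo each [R,R]U, and [R,R] is the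
  -- intersection of these within R, so the congruence passes to the limit.
  ·̂-cong : ∀ z (a b : R.Carrier) → proj₁ a D.∼ proj₁ b → proj₁ (z ·̂ a) D.∼ proj₁ (z ·̂ b)
  ·̂-cong z a b a∼b = close (·̂-approx z a) (·̂-approx z b) (proj₂ (z ·̂ a)) (proj₂ (z ·̂ b))
    where
    y = proj₁ a
    y′ = proj₁ b
    V : F.Index → NormalSubgroup F.group
    V i = product F.group derivedR (F.Nbhd i)
    module V i = Quotient F.group (V i)
    module U i = Quotient F.group (F.Nbhd i)
    U⊆V : ∀ i {u} → ⟨ F.Nbhd i ⟩ u → ⟨ V i ⟩ u
    U⊆V i u∈ = F.ε , NormalSubgroup.ε-closed derivedR , U.∼-sym i (U.Mem⇒∼ε i u∈)
    ^-cong : ∀ i n → V._∼_ i (y ^ n) (y′ ^ n)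
    ^-cong i ℕ.zero    = V.≈⇒∼ i F.refl
    ^-cong i (ℕ.suc n) = V.∼-∙-cong i (let ((a , q) , c , r) = proj₂ a∼b i in a , (q , c) , r) (^-cong i n)
    close : ∀ {u v} → (∀ i → u F.≈[ i ] y ^ residue z i) → (∀ i → v F.≈[ i ] y′ ^ residue z i) →
            R∼.Mem u → R∼.Mem v → u D.∼ v
    close u∼ v∼ u∈R v∈R = π≈⇒∼ (H.trans u∈R (H.sym v∈R)) , λ i →
      let (a , (q , c) , r) = V.∼-trans i (U⊆V i (u∼ i))
            (V.∼-trans i (^-cong i (residue z i)) (U⊆V i (U.∼-sym i (v∼ i))))
      in (a , q) , c , r

  -- Ẑ-linearity is a consequence of continuity, since α respects powers and their limits.
  -- Equivariance and the invariance of β come from the endomorphism that α induces on F/[R,R].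
  Image-ρ⊆Aut[H,β] : Image-ρ ⊆ Aut[H,β]
  Image-ρ⊆Aut[H,β] {γ} (α , ρα≈γ) = linear , record
      { cochain = Trivialisation.b t ; cong₁ = Trivialisation.b-cong t ; coboundary = Trivialisation.b-relation t }
    where
    open A[π] α using (aut; π∘α)
    f = TopAut.to aut
    φ = ContHom.hom (TopAut.to γ)
    θ : Hom F/[R,R] F/[R,R]
    θ = mkHom F/[R,R] F/[R,R] (apply f)
      (λ {y} {z} p → NormalSubgroup.resp [R,R]-in-F
        (F.trans (ContHom.homo f _ _) (F.∙-congʳ (ContHom.⁻¹-homo f y)))
        (D-map f (λ z → π≈⇒∼ (π∘α z)) p))
      (λ y z → D.≈⇒∼ (ContHom.homo f y z))
    α∼γ : ∀ a → apply f (proj₁ a) D.∼ proj₁ (apply (TopAut.to γ) a)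
    α∼γ a = R̄≈⇒∼ (apply (TopAut.to (ρ α)) a) (apply (TopAut.to γ) a) (ρα≈γ a)
    ι∘φ : ∀ a → proj₁ (apply (TopAut.to γ) a) D.∼ apply f (proj₁ a)
    ι∘φ a = D.∼-sym (α∼γ a)
    γ-·̂ : ∀ z a → proj₁ (apply (TopAut.to γ) (z ·̂ a)) D.∼ proj₁ (z ·̂ apply (TopAut.to γ) a)
    γ-·̂ z a = D.∼-trans (ι∘φ (z ·̂ a)) (D.∼-trans
      (D.≈⇒∼ (limit-map f (residue z) (·̂-approx z a) (·̂-approx z (apply (TopAut.to (ρ α)) a))))
      (·̂-cong z (apply (TopAut.to (ρ α)) a) (apply (TopAut.to γ) a) (α∼γ a)))
    open HModule R̄-module using (_·_)
    equivariant : ∀ h a → proj₁ (apply (TopAut.to γ) (h · a)) D.∼ proj₁ (h · apply (TopAut.to γ) a)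
    equivariant h a = R̄≈⇒∼ (apply (TopAut.to γ) (h · a)) (h · apply (TopAut.to γ) a)
      (restriction-equivariant θ π∘α φ ι∘φ h a)
    linear-∼ : ∀ r a → proj₁ (apply (TopAut.to γ) (r ⋆ a)) D.∼ proj₁ (r ⋆ apply (TopAut.to γ) a)
    linear-∼ [] a = R̄≈⇒∼ (apply (TopAut.to γ) R̄.ε) R̄.ε (ContHom.ε-homo (TopAut.to γ))
    linear-∼ ((z , h) ∷ r) a = D.∼-trans
      (R̄≈⇒∼ (apply (TopAut.to γ) (z ·̂ (h · a) R̄.∙ r ⋆ a))
        (apply (TopAut.to γ) (z ·̂ (h · a)) R̄.∙ apply (TopAut.to γ) (r ⋆ a))
        (ContHom.homo (TopAut.to γ) (z ·̂ (h · a)) (r ⋆ a)))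
      (D.∼-∙-cong (D.∼-trans (γ-·̂ z (h · a))
          (·̂-cong z (apply (TopAut.to γ) (h · a)) (h · apply (TopAut.to γ) a) (equivariant h a)))
        (linear-∼ r a))
    linear : IsẐ[H]Linear γ
    linear r a = ∼⇒R̄≈ (apply (TopAut.to γ) (r ⋆ a)) (r ⋆ apply (TopAut.to γ) a) (linear-∼ r a)
    t = restriction-trivialisation θ π∘α φ ι∘φ

  Aut[H,β]⊆Image-ρ : Aut[H,β] ⊆ Image-ρ
  Aut[H,β]⊆Image-ρ {γ} (linear , β-preserved) =
      α∈A[π]
    , λ a → ∼⇒R̄≈ (apply (TopAut.to (ρ α∈A[π])) a) (apply (TopAut.to γ) a)
        (D.∼-trans (proj₂ α (proj₁ a)) (extended∘ι φ t a))
    where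
    φ = toModuleHom γ linear
    t : Trivialisation (RelationModule.R̄-module F H π π-surjective) (apply (TopAut.to γ))
          (Cocycle₂.fun (RelationModule.β F H π π-surjective))
    t = record
      { b = IsCoboundary.cochain β-preserved
      ; b-cong = IsCoboundary.cong₁ β-preserved
      ; b-relation = IsCoboundary.coboundary β-preserved }
    θ = extended φ t
    -- R is open, and on R the map θ is γ up to [R,R], so the continuity of γ suffices.
    continuous : ∀ n → ∃ λ i → ∀ {z} → ⟨ F.Nbhd i ⟩ z → C.Mem n (θ z)
    continuous n =
      let (j , j⊆)     = L.open? n
          (i , γ-cont) = ContHom.continuous (TopAut.to γ) j
          (k , k⊆R)    = ContHom.continuous π tt
          (l , l⊆i , l⊆k) = F.directed i k
      in l , λ {z} z∈l →
        let a = z , k⊆R (l⊆k z∈l)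
            (b , b∈j , b∼γa) = γ-cont {a} (a , l⊆i z∈l , R̄.refl {a})
        in C.∼ε⇒Mem n (C.∼-trans n (D⊆C n (extended∘ι φ t a))
             (C.∼-trans n (C.∼-sym n (D⊆C n (ι.⟦⟧-cong {b} {apply (TopAut.to γ) a} b∼γa)))
               (C.Mem⇒∼ε n (L⊆C n (j⊆ b∈j)))))
    α = Lift.lift record
      { θ = θ
      ; θ-cong = λ p → extended-cong φ t (D.≈⇒∼ p)
      ; θ-homo = extended-homo φ t
      ; θ-cont = continuous
      ; π∘θ = λ z → π≈⇒∼ (p∘extended φ t z)
      ; θ-surj = extended-surjective φ t
          (λ a → apply (TopAut.from γ) a , TopAut.invˡ γ a) }
    α∈A[π] : A[π]
    α∈A[π] = record
      { aut = proj₁ α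
      ; π∘α = λ z → π̄-cong (R∼.∼-trans (D⊆R (proj₂ α z)) (π≈⇒∼ (p∘extended φ t z))) }

theorem1p3 : (d : ℕ) → 1 ≤ d →
    (F : ProfiniteGroup) (x : Fin d → ProfiniteGroup.Carrier F) → IsFreeProfinite F x →
    (H : FiniteGroup) (π : ContHom (ProfiniteGroup.top F) (discrete H))
    (π-surjective : Surjective (ProfiniteGroup._≈_ F) (FiniteGroup._≈_ H) (apply π)) →
    let open RelationModule F H π π-surjective in
    Image-ρ ≐ Aut[H,β]
theorem1p3 d _ F x free H π π-surjective = (λ {γ} → Image-ρ⊆Aut[H,β] {γ}) , (λ {γ} → Aut[H,β]⊆Image-ρ {γ})
  where open Theorem F x free H π π-surjective
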